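{- Let $n\ge1$. The restriction of $\Phi$ to $\mathfrak{S}_n(231)$ is a bijection from $\mathfrak{S}_n(231)$ onto $\mathfrak{S}_n(321)$. Moreover, for $\sigma\in\mathfrak{S}_n(231)$, $$(31\text{ - }2,\ \mathsf{des},\ \mathsf{asc}^\infty,\ \mathsf{lda}-\mathsf{fmax},\ \mathsf{ldd},\ \mathsf{lval},\ \mathsf{lpk},\ \mathsf{fmax})\,\sigma=(\mathsf{icr},\ \mathsf{drop},\ \mathsf{exc}+\mathsf{fix},\ \mathsf{cda},\ \mathsf{cdd},\ \mathsf{cval},\ \mathsf{cpk},\ \mathsf{fix})\,\Phi(\sigma)$$ $$=(\mathsf{cros},\ \mathsf{exc},\ \mathsf{drop}+\mathsf{fix},\ \mathsf{cdd},\ \mathsf{cda},\ \mathsf{cval},\ \mathsf{cpk},\ \mathsf{fix})\,(\Phi(\sigma))^{ -1}.$$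
   Context: The map $\Phi:\mathfrak{S}_n\to\mathfrak{S}_n$: for $\rho\in\mathfrak{S}_n$, a letter $\rho(i)$ is a descent top if $i\le n-1$ and $\rho(i)>\rho(i+1)$, a descent bottom if $i\ge2$ and $\rho(i-1)>\rho(i)$; otherwise a nondescent top (resp. bottom). For $x=\rho(i)$ let $c(x)=\#\{j:i<j<n,\ \rho(j+1)<x<\rho(j)\}$. Let $f$ (resp. $g$) be the increasing word of descent bottoms (resp. nondescent bottoms); $f'$ the arrangement of the descent tops in which each letter $x$ has exactly $c(x)$ larger letters to its left; $g'$ the arrangement of the nondescent tops in which each letter $x$ has exactly $c(x)$ smaller letters to its right. With the two-row array of top row $fg$ and bottom row $f'g'$, $\Phi(\rho)=\tau$ with $\tau(b)=a$ for each column (top $a$, bottom $b$). Statistics of $\sigma$: $(31\text{ - }2)\sigma=\#\{(i,j):i+1<j\le n,\ \sigma(i+1)<\sigma(j)<\sigma(i)\}$; $\mathsf{des}\,\sigma=\#\{i\in[n-1]:\sigma(i)>\sigma(i+1)\}$; $\mathsf{asc}^\infty\sigma=\#\{i\in[n]:\sigma(i)<\sigma(i+1)\}$ with $\sigma(n+1)=\infty$ (i.e. $n-\mathsf{des}\,\sigma$). With convention $\sigma(0)=0,\sigma(n+1)=\infty$: $\mathsf{lpk},\mathsf{lval},\mathsf{lda},\mathsf{ldd}$ count $i\in[n]$ with $\sigma(i-1)<\sigma(i)>\sigma(i+1)$, $\sigma(i-1)>\sigma(i)<\sigma(i+1)$, $\sigma(i-1)<\sigma(i)<\sigma(i+1)$,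 $\sigma(i-1)>\sigma(i)>\sigma(i+1)$ respectively; $\mathsf{fmax}$ counts such double ascents that are left-to-right maxima. Statistics of $\pi$: $\mathsf{exc},\mathsf{drop},\mathsf{fix}$ count $i$ with $\pi(i)>i$, $\pi(i)<i$, $\pi(i)=i$; $\mathsf{cpk},\mathsf{cval},\mathsf{cda},\mathsf{cdd}$ count values $x$ with $\pi^{ -1}(x)<x>\pi(x)$, $\pi^{ -1}(x)>x<\pi(x)$, $\pi^{ -1}(x)<x<\pi(x)$, $\pi^{ -1}(x)>x>\pi(x)$; $\mathsf{cros}\,\pi=\sum_i\#\{j:j<i<\pi(j)<\pi(i)\text{ or }\pi(i)<\pi(j)\le i<j\}$ and $\mathsf{icr}\,\pi=\mathsf{cros}\,\pi^{ -1}$. -}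

module Defs where

open import Data.Empty using (⊥-elim)
open import Data.Fin.Base as Fin using (Fin; toℕ; fromℕ<)
import Data.Fin.Properties as Fin
open import Data.Fin.Permutation
  using (Permutation; Permutation′; permutation; _⟨$⟩ʳ_; _⟨$⟩ˡ_; _≈_; flip; _∘ₚ_; cast-id; inverseˡ; inverseʳ)
open import Data.List.Base as List
  using (List; []; _∷_; _++_; [_]; allFin; filter; foldr; length; lookup; map; reverse; take; zip)
open import Data.List.Membership.Propositional using (_∈_)
open import Data.List.Membership.Propositional.Properties
  using (∈-allFin; ∈-filter⁺; ∈-filter⁻; ∈-∃++; ∈-++⁻; ∈-insert; ∈-lookup)
import Data.List.Properties as List
open import Data.List.Relation.Binary.Permutation.Propositional
  using (_↭_; prep; ↭-refl; ↭-reflexive; ↭-sym; ↭-trans)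
open import Data.List.Relation.Binary.Permutation.Propositional.Properties
  using (shift; drop-mid; ∈-resp-↭; ↭-empty-inv; ↭-length; ↭-reverse; filter-↭; ++⁺)
open import Data.List.Relation.Unary.All as All using (All; []; _∷_)
open import Data.List.Relation.Unary.AllPairs as AllPairs using (AllPairs; []; _∷_)
import Data.List.Relation.Unary.AllPairs.Properties as AllPairs
open import Data.List.Relation.Unary.Any as Any using (here; there; index)
open import Data.List.Relation.Unary.Any.Properties using (lookup-index)
open import Data.List.Relation.Unary.Unique.Propositional using (Unique)
import Data.List.Relation.Unary.Unique.Propositional.Properties as Unique
open import Data.Nat.Base using (ℕ; zero; suc; _+_; _∸_; _≤_; _<_; z≤n; s≤s; s≤s⁻¹)
open import Data.Nat.ListAction using (sum)
open import Data.Nat.Properties as ℕ using (_<?_)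
open import Data.Product.Base using (Σ; _×_; _,_; proj₁; proj₂; ∃; ∃₂; ∃-syntax)
open import Data.Sum.Base using (_⊎_; inj₁; inj₂)
open import Function.Base using (_∘_)
open import Level using (0ℓ)
open import Relation.Binary.Bundles using (Setoid)
import Relation.Binary.Construct.On as On
open import Relation.Binary.Definitions using (tri<; tri≈; tri>)
open import Relation.Binary.PropositionalEquality
  using (_≡_; _≢_; refl; sym; trans; cong; cong₂; subst; subst₂; module ≡-Reasoning)
open import Relation.Nullary using (¬_; yes; no)
open import Relation.Nullary.Decidable using (_×-dec_; _⊎-dec_; _→-dec_)
open import Relation.Unary using (Pred; Decidable; ∁)
open import Relation.Unary.Properties using (∁?)

private
  variable
    n : ℕ

-- Positions and letters of a permutation of [n] are both 0-based, as elements
-- of Fin n; `letter` and `ext` give the 1-based letters.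

#_ : {P : Pred (Fin n) 0ℓ} → Decidable P → ℕ
# P? = length (filter P? (allFin _))

letter : Permutation′ n → Fin n → ℕ
letter σ i = suc (toℕ (σ ⟨$⟩ʳ i))

-- The word σ(0) σ(1) … σ(n) σ(n+1) with 1-based positions, where σ(0) = 0 and
-- σ(n+1) = ∞. Since it is only ever compared with letters, ∞ is encoded as
-- n + 1 (as are the irrelevant values at positions beyond n + 1).
ext : Permutation′ n → ℕ → ℕ
ext σ zero = 0
ext {n} σ (suc k) with k <? n
... | yes k<n = letter σ (fromℕ< k<n)
... | no  _   = suc n

-- With i the 0-based position, these are σ(i-1) and σ(i+1) under the boundary
-- conventions above. In particular the last position is never a descent and
-- the first one never follows a descent, so the side conditions i ≤ n - 1 and
-- i ≥ 2 on descent tops and bottoms need not be repeated below.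
before after : Permutation′ n → Fin n → ℕ
before σ i = ext σ (toℕ i)
after  σ i = ext σ (2 + toℕ i)

31-2 des asc∞ lpk lval lda ldd fmax : Permutation′ n → ℕ
31-2 {n} σ = sum (map (λ i → # (λ j → (suc (toℕ i) <? toℕ j)
                                ×-dec (after σ i <? letter σ j)
                                ×-dec (letter σ j <? letter σ i)))
                      (allFin n))
des  σ = # λ i → after σ i <? letter σ i
asc∞ σ = # λ i → letter σ i <? after σ i
lpk  σ = # λ i → (before σ i <? letter σ i) ×-dec (after σ i <? letter σ i)
lval σ = # λ i → (letter σ i <? before σ i) ×-dec (letter σ i <? after σ i)
lda  σ = # λ i → (before σ i <? letter σ i) ×-dec (letter σ i <? after σ i)
ldd  σ = # λ i → (letter σ i <? before σ i) ×-dec (after σ i <? letter σ i)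
fmax σ = # λ i → ((before σ i <? letter σ i) ×-dec (letter σ i <? after σ i))
                 ×-dec Fin.all? (λ j → (j Fin.<? i) →-dec (letter σ j <? letter σ i))

exc drop fix cpk cval cda cdd cros icr : Permutation′ n → ℕ
exc  π = # λ i → i Fin.<? π ⟨$⟩ʳ i
drop π = # λ i → π ⟨$⟩ʳ i Fin.<? i
fix  π = # λ i → π ⟨$⟩ʳ i Fin.≟ i
cpk  π = # λ x → (π ⟨$⟩ˡ x Fin.<? x) ×-dec (π ⟨$⟩ʳ x Fin.<? x)
cval π = # λ x → (x Fin.<? π ⟨$⟩ˡ x) ×-dec (x Fin.<? π ⟨$⟩ʳ x)
cda  π = # λ x → (π ⟨$⟩ˡ x Fin.<? x) ×-dec (x Fin.<? π ⟨$⟩ʳ x)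
cdd  π = # λ x → (x Fin.<? π ⟨$⟩ˡ x) ×-dec (π ⟨$⟩ʳ x Fin.<? x)
cros {n} π = sum (map (λ i → # λ j →
    ((j Fin.<? i) ×-dec (i Fin.<? π ⟨$⟩ʳ j) ×-dec (π ⟨$⟩ʳ j Fin.<? π ⟨$⟩ʳ i))
    ⊎-dec
    ((π ⟨$⟩ʳ i Fin.<? π ⟨$⟩ʳ j) ×-dec (π ⟨$⟩ʳ j Fin.≤? i) ×-dec (i Fin.<? j)))
  (allFin n))
icr π = cros (flip π)

Avoids231 Avoids321 : Permutation′ n → Set
Avoids231 {n} σ = ¬ (∃[ i ] ∃[ j ] ∃[ k ]
  i Fin.< j × j Fin.< k × σ ⟨$⟩ʳ k Fin.< σ ⟨$⟩ʳ i × σ ⟨$⟩ʳ i Fin.< σ ⟨$⟩ʳ j)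
Avoids321 {n} σ = ¬ (∃[ i ] ∃[ j ] ∃[ k ]
  i Fin.< j × j Fin.< k × σ ⟨$⟩ʳ k Fin.< σ ⟨$⟩ʳ j × σ ⟨$⟩ʳ j Fin.< σ ⟨$⟩ʳ i)

𝔖 𝔖231 𝔖321 : ℕ → Setoid 0ℓ 0ℓ
𝔖 n = record
  { Carrier       = Permutation′ n
  ; _≈_           = _≈_
  ; isEquivalence = record
    { refl  = λ _ → refl
    ; sym   = λ p i → sym (p i)
    ; trans = λ p q i → trans (p i) (q i)
    }
  }
𝔖231 n = On.setoid {B = Σ (Permutation′ n) Avoids231} (𝔖 n) proj₁
𝔖321 n = On.setoid {B = Σ (Permutation′ n) Avoids321} (𝔖 n) proj₁

DescentTop DescentBottom : Permutation′ n → Pred (Fin n) 0ℓ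
DescentTop    ρ x = after ρ (ρ ⟨$⟩ˡ x) < letter ρ (ρ ⟨$⟩ˡ x)
DescentBottom ρ x = letter ρ (ρ ⟨$⟩ˡ x) < before ρ (ρ ⟨$⟩ˡ x)

DescentTop? : (ρ : Permutation′ n) → Decidable (DescentTop ρ)
DescentTop? ρ x = _ <? _

DescentBottom? : (ρ : Permutation′ n) → Decidable (DescentBottom ρ)
DescentBottom? ρ x = _ <? _

-- Increasing words, because allFin is increasing.
descentTops nondescentTops descentBottoms nondescentBottoms :
  Permutation′ n → List (Fin n)
descentTops       ρ = filter (DescentTop? ρ) (allFin _)
nondescentTops    ρ = filter (∁? (DescentTop? ρ)) (allFin _)
descentBottoms    ρ = filter (DescentBottom? ρ) (allFin _)
nondescentBottoms ρ = filter (∁? (DescentBottom? ρ)) (allFin _)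

c : Permutation′ n → Fin n → ℕ
c ρ x = # λ j → (ρ ⟨$⟩ˡ x Fin.<? j)
                ×-dec (after ρ j <? suc (toℕ x)) ×-dec (suc (toℕ x) <? letter ρ j)

LargerToLeft SmallerToRight : (Fin n → ℕ) → List (Fin n) → Set
LargerToLeft {n} m w = ∀ u (x : Fin n) v → w ≡ u ++ x ∷ v →
  length (filter (x Fin.<?_) u) ≡ m x
SmallerToRight {n} m w = ∀ u (x : Fin n) v → w ≡ u ++ x ∷ v →
  length (filter (Fin._<? x) v) ≡ m x

record IsΦ {n} (ρ τ : Permutation′ n) : Set where
  field
    f′ g′    : List (Fin n)
    f′-arr   : f′ ↭ descentTops ρ
    g′-arr   : g′ ↭ nondescentTops ρ
    f′-code  : LargerToLeft (c ρ) f′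
    g′-code  : SmallerToRight (c ρ) g′
    columns  : ∀ {a b} →
      (a , b) ∈ zip (descentBottoms ρ ++ nondescentBottoms ρ) (f′ ++ g′) →
      τ ⟨$⟩ʳ b ≡ a

private
  module Lists {A : Set} where

    split : ∀ (as : List A) {bs} us {z vs} → as ++ bs ≡ us ++ z ∷ vs →
            (∃[ d ] as ≡ us ++ z ∷ d × vs ≡ d ++ bs) ⊎
            (∃[ d ] us ≡ as ++ d × bs ≡ d ++ z ∷ vs)
    split []       us       eq   = inj₂ (us , refl , eq)
    split (a ∷ as) []       refl = inj₁ (as , refl , refl)
    split (a ∷ as) (u ∷ us) eq with refl , eq′ ← List.∷-injective eq | split as us eq′
    ... | inj₁ (d , p , q) = inj₁ (d , cong (a ∷_) p , q)
    ... | inj₂ (d , p , q) = inj₂ (d , cong (a ∷_) p , q)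

    filter-partition : ∀ {P : Pred A 0ℓ} (P? : Decidable P) xs →
                       filter P? xs ++ filter (∁? P?) xs ↭ xs
    filter-partition P? []       = ↭-refl
    filter-partition P? (x ∷ xs) with P? x
    ... | yes _ = prep x (filter-partition P? xs)
    ... | no  _ = ↭-trans (shift x (filter P? xs) _) (prep x (filter-partition P? xs))

    lookup-injective : ∀ {xs : List A} → Unique xs → ∀ i j →
                       lookup xs i ≡ lookup xs j → i ≡ j
    lookup-injective (px ∷ u) Fin.zero    Fin.zero    eq = refl
    lookup-injective (px ∷ u) Fin.zero    (Fin.suc j) eq = ⊥-elim (All.lookup px (∈-lookup j) eq)
    lookup-injective (px ∷ u) (Fin.suc i) Fin.zero    eq = ⊥-elim (All.lookup px (∈-lookup i) (sym eq))
    lookup-injective (px ∷ u) (Fin.suc i) (Fin.suc j) eq = cong Fin.suc (lookup-injective u i j eq)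

    Unique-↭ : ∀ {xs ys : List A} → xs ↭ ys → Unique xs → Unique ys
    Unique-↭ = PS.Unique-resp-↭ ∘ P↭.↭⇒↭ₛ
      where import Data.List.Relation.Binary.Permutation.Setoid.Properties as PSP
            import Relation.Binary.PropositionalEquality as E
            module PS = PSP (E.setoid A)
            import Data.List.Relation.Binary.Permutation.Propositional as P↭

    AllPairs-left : ∀ {R : A → A → Set} u {x v y} → AllPairs R (u ++ x ∷ v) → y ∈ u → R y x
    AllPairs-left (_ ∷ u) (px ∷ _)  (here refl) = All.lookup px (∈-insert u)
    AllPairs-left (_ ∷ u) (_ ∷ ap) (there y∈u)  = AllPairs-left u ap y∈u

    AllPairs-reverse : ∀ {R : A → A → Set} {xs} → AllPairs R xs → AllPairs (λ x y → R y x) (reverse xs)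
    AllPairs-reverse {xs = []}     []        = []
    AllPairs-reverse {xs = x ∷ xs} (px ∷ ap) =
      subst (AllPairs _) (sym (List.unfold-reverse x xs))
        (AllPairs.++⁺ (AllPairs-reverse ap) ([] ∷ [])
          (All.tabulate λ y∈ → All.lookup px (∈-resp-↭ (↭-reverse xs) y∈) ∷ []))

  zip⁻ : ∀ {A B : Set} (as : List A) (bs : List B) {a b} → (a , b) ∈ zip as bs →
         ∃₂ λ i j → toℕ i ≡ toℕ j × lookup as i ≡ a × lookup bs j ≡ b
  zip⁻ (a ∷ as) (b ∷ bs) (here refl) = Fin.zero , Fin.zero , refl , refl , refl
  zip⁻ (a ∷ as) (b ∷ bs) (there p)   with i , j , e , p , q ← zip⁻ as bs p =
    Fin.suc i , Fin.suc j , cong suc e , p , q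

  zip⁺ : ∀ {A B : Set} (as : List A) (bs : List B) i j → toℕ i ≡ toℕ j →
         (lookup as i , lookup bs j) ∈ zip as bs
  zip⁺ (a ∷ as) (b ∷ bs) Fin.zero    Fin.zero    e = here refl
  zip⁺ (a ∷ as) (b ∷ bs) (Fin.suc i) (Fin.suc j) e = there (zip⁺ as bs i j (ℕ.suc-injective e))

  pigeonhole : ∀ {A B : Set} {R : A → B → Set} {L : List A} {M : List B} → Unique L →
               (∀ {j} → j ∈ L → ∃[ b ] b ∈ M × R j b) →
               (∀ {i j b} → i ∈ L → j ∈ L → R i b → R j b → i ≡ j) →
               length L ≤ length M
  pigeonhole [] img inj = z≤n
  pigeonhole {R = R} {L = x ∷ L} (px ∷ uL) img inj
    with b , b∈M , Rxb ← img (here refl)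
    with u , v , refl ← ∈-∃++ b∈M =
    subst (suc (length L) ≤_) (sym (↭-length (shift b u v)))
      (s≤s (pigeonhole uL img′ λ i∈ j∈ → inj (there i∈) (there j∈)))
    where
    img′ : ∀ {j} → j ∈ L → ∃[ b′ ] b′ ∈ u ++ v × R j b′
    img′ j∈ with b′ , b′∈ , Rjb′ ← img (there j∈)
            with ∈-resp-↭ (shift b u v) b′∈
    ... | there q   = b′ , q , Rjb′
    ... | here refl = ⊥-elim (All.lookup px j∈ (inj (here refl) (there j∈) Rxb Rjb′))

open Lists

-- Reconstructing a word from a code. The letters of xs are inserted from the
-- last to the first, each letter x with m x letters to its left.
arrange : {A : Set} → (A → ℕ) → List A → List A
arrange m = foldr (λ x w → take (m x) w ++ x ∷ List.drop (m x) w) []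

private
  module Arrange {A : Set} {R : A → A → Set} (R? : ∀ x → Decidable (R x))
                 (asym : ∀ {x y} → R x y → ¬ R y x) (m : A → ℕ) where

    Code : List A → Set
    Code w = ∀ u x v → w ≡ u ++ x ∷ v → length (filter (R? x) u) ≡ m x

    arrange-↭ : ∀ xs → arrange m xs ↭ xs
    arrange-↭ []       = ↭-refl
    arrange-↭ (x ∷ xs) =
      ↭-trans (shift x (take (m x) w) _)
              (prep x (↭-trans (↭-reflexive (List.take++drop≡id (m x) w)) (arrange-↭ xs)))
      where w = arrange m xs

    filter-skip : ∀ z u {x} d → ¬ R z x →
                  filter (R? z) (u ++ x ∷ d) ≡ filter (R? z) (u ++ d)
    filter-skip z u {x} d ¬Rzx = begin
      filter (R? z) (u ++ x ∷ d)               ≡⟨ List.filter-++ (R? z) u (x ∷ d) ⟩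
      filter (R? z) u ++ filter (R? z) (x ∷ d) ≡⟨ cong (filter (R? z) u ++_) (List.filter-reject (R? z) ¬Rzx) ⟩
      filter (R? z) u ++ filter (R? z) d       ≡⟨ List.filter-++ (R? z) u d ⟨
      filter (R? z) (u ++ d)                   ∎
      where open ≡-Reasoning

    code-insert : ∀ a {x} b → All (R x) (a ++ b) → length a ≡ m x →
                  Code (a ++ b) → Code (a ++ x ∷ b)
    code-insert a {x} b all len code u z v eq with split a u eq
    ... | inj₁ (d , refl , refl)         = code u z (d ++ b) (List.++-assoc u (z ∷ d) b)
    ... | inj₂ ([] , refl , refl)        =
      trans (cong length (List.filter-all (R? x)
              (All.tabulate λ y∈ → All.lookup all (subst (_ ∈_) (cong (_++ b) (List.++-identityʳ a))
                                                    (∈-++ˡ y∈)))))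
            (trans (cong length (List.++-identityʳ a)) len)
      where ∈-++ˡ : ∀ {y xs} → y ∈ xs → y ∈ xs ++ b
            ∈-++ˡ (here p)  = here p
            ∈-++ˡ (there p) = there (∈-++ˡ p)
    ... | inj₂ (_ ∷ d , refl , refl) =
      trans (cong length (filter-skip z a d ¬Rzx))
            (code (a ++ d) z v (sym (List.++-assoc a d (z ∷ v))))
      where ¬Rzx : ¬ R z x
            ¬Rzx = asym (All.lookup all (subst (z ∈_) (List.++-assoc a d (z ∷ v)) (∈-insert (a ++ d))))

    code-delete : ∀ a {x} b → All (R x) (a ++ b) → Code (a ++ x ∷ b) → Code (a ++ b)
    code-delete a {x} b all code u z v eq with split a u eq
    ... | inj₁ (d , refl , refl) = code u z (d ++ x ∷ b) (List.++-assoc u (z ∷ d) (x ∷ b))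
    ... | inj₂ (d , refl , refl) =
      trans (cong length (sym (filter-skip z a d ¬Rzx)))
            (code (a ++ x ∷ d) z v (sym (List.++-assoc a (x ∷ d) (z ∷ v))))
      where ¬Rzx : ¬ R z x
            ¬Rzx = asym (All.lookup all (subst (z ∈_) (List.++-assoc a d (z ∷ v)) (∈-insert (a ++ d))))

    arrange-code : ∀ {xs} → AllPairs R xs →
                   (∀ u x v → xs ≡ u ++ x ∷ v → m x ≤ length v) → Code (arrange m xs)
    arrange-code []                    _     []      _ _ ()
    arrange-code []                    _     (_ ∷ _) _ _ ()
    arrange-code {x ∷ xs} (px ∷ ap) bound =
      code-insert (take (m x) w) (List.drop (m x) w)
        (subst (All (R x)) (sym t++d) (All.tabulate λ y∈ → All.lookup px (∈-resp-↭ (arrange-↭ xs) y∈)))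
        (trans (List.length-take (m x) w)
               (ℕ.m≤n⇒m⊓n≡m (subst (m x ≤_) (sym (↭-length (arrange-↭ xs))) (bound [] x xs refl))))
        (subst Code (sym t++d) (arrange-code ap λ u y v eq → bound (x ∷ u) y v (cong (x ∷_) eq)))
      where w = arrange m xs
            t++d = List.take++drop≡id (m x) w

    arrange-unique : ∀ {xs} → AllPairs R xs → ∀ {w} → w ↭ xs → Code w → w ≡ arrange m xs
    arrange-unique []                p code = ↭-empty-inv p
    arrange-unique {x ∷ xs} (px ∷ ap) p code
      with u , v , refl ← ∈-∃++ (∈-resp-↭ (↭-sym p) (here refl)) = begin
        u ++ x ∷ v                                                       ≡⟨ cong₂ (λ s t → s ++ x ∷ t) (take-≡ u v) (drop-≡ u v) ⟨
        take (length u) (u ++ v) ++ x ∷ List.drop (length u) (u ++ v)   ≡⟨ cong₂ (λ k w → take k w ++ x ∷ List.drop k w) len ih ⟩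
        arrange m (x ∷ xs)                                               ∎
      where
      open ≡-Reasoning
      q : u ++ v ↭ xs
      q = drop-mid u [] p
      all : All (R x) (u ++ v)
      all = All.tabulate λ y∈ → All.lookup px (∈-resp-↭ q y∈)
      ∈-++ˡ : ∀ {y} (a : List A) {b} → y ∈ a → y ∈ a ++ b
      ∈-++ˡ (_ ∷ _) (here e)  = here e
      ∈-++ˡ (_ ∷ a) (there e) = there (∈-++ˡ a e)
      len : length u ≡ m x
      len = trans (cong length (sym (List.filter-all (R? x)
                     (All.tabulate λ y∈ → All.lookup all (∈-++ˡ u y∈)))))
                  (code u x v refl)
      ih : u ++ v ≡ arrange m xs
      ih = arrange-unique ap q (code-delete u v all code)
      take-≡ : ∀ (a b : List A) → take (length a) (a ++ b) ≡ a
      take-≡ []      b = refl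
      take-≡ (x ∷ a) b = cong (x ∷_) (take-≡ a b)
      drop-≡ : ∀ (a b : List A) → List.drop (length a) (a ++ b) ≡ b
      drop-≡ []      b = refl
      drop-≡ (x ∷ a) b = drop-≡ a b

  module Larger {n} (m : Fin n → ℕ) =
    Arrange {R = λ x y → x Fin.< y} (λ x y → x Fin.<? y) (λ p q → ℕ.<-asym p q) m
  module Smaller {n} (m : Fin n → ℕ) =
    Arrange {R = λ x y → y Fin.< x} (λ x y → y Fin.<? x) (λ p q → ℕ.<-asym p q) m

-- A word containing every letter once, as the bijection position ↦ letter.
wordPermutation : (w : List (Fin n)) → w ↭ allFin n → Permutation (length w) n
wordPermutation {n} w w↭ = permutation (lookup w) pos
  (λ x → sym (lookup-index (mem x)))
  (λ i → lookup-injective (Unique-↭ (↭-sym w↭) (Unique.allFin⁺ n)) _ _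
           (sym (lookup-index (mem (lookup w i)))))
  where
  mem : ∀ x → x ∈ w
  mem x = ∈-resp-↭ (↭-sym w↭) (∈-allFin x)
  pos : Fin n → Fin (length w)
  pos x = index (mem x)

-- f′ inserts the descent tops from the largest to the smallest, each x with
-- c(x) letters to its left. g′ inserts the nondescent tops from the smallest
-- to the largest, each x with c(x) letters to its right.
arrangedDescentTops arrangedNondescentTops : Permutation′ n → List (Fin n)
arrangedDescentTops    ρ = arrange (c ρ) (descentTops ρ)
arrangedNondescentTops ρ = reverse (arrange (c ρ) (reverse (nondescentTops ρ)))

topRow bottomRow : Permutation′ n → List (Fin n)
topRow    ρ = descentBottoms ρ ++ nondescentBottoms ρ
bottomRow ρ = arrangedDescentTops ρ ++ arrangedNondescentTops ρ

arrangedDescentTops-↭ : (ρ : Permutation′ n) → arrangedDescentTops ρ ↭ descentTops ρ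
arrangedDescentTops-↭ ρ = Larger.arrange-↭ (c ρ) _

arrangedNondescentTops-↭ : (ρ : Permutation′ n) → arrangedNondescentTops ρ ↭ nondescentTops ρ
arrangedNondescentTops-↭ ρ =
  ↭-trans (↭-reverse _) (↭-trans (Smaller.arrange-↭ (c ρ) _) (↭-reverse _))

topRow-↭ : (ρ : Permutation′ n) → topRow ρ ↭ allFin n
topRow-↭ ρ = filter-partition (DescentBottom? ρ) _

bottomRow-↭ : (ρ : Permutation′ n) → bottomRow ρ ↭ allFin n
bottomRow-↭ ρ = ↭-trans (++⁺ (arrangedDescentTops-↭ ρ) (arrangedNondescentTops-↭ ρ))
                        (filter-partition (DescentTop? ρ) _)

rows-length : (ρ : Permutation′ n) → length (bottomRow ρ) ≡ length (topRow ρ)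
rows-length ρ = ↭-length (↭-trans (bottomRow-↭ ρ) (↭-sym (topRow-↭ ρ)))

Φ : Permutation′ n → Permutation′ n
Φ ρ = flip (wordPermutation (bottomRow ρ) (bottomRow-↭ ρ))
      ∘ₚ cast-id (rows-length ρ)
      ∘ₚ wordPermutation (topRow ρ) (topRow-↭ ρ)

private
  module Bounds {n} (ρ : Permutation′ n) where

    tops-sorted : AllPairs Fin._<_ (descentTops ρ)
    tops-sorted = AllPairs.filter⁺ (DescentTop? ρ) (AllPairs.tabulate⁺-< λ i<j → i<j)

    nontops-sorted : AllPairs (λ x y → y Fin.< x) (reverse (nondescentTops ρ))
    nontops-sorted = AllPairs-reverse
      (AllPairs.filter⁺ (∁? (DescentTop? ρ)) (AllPairs.tabulate⁺-< λ i<j → i<j))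

    Straddles : Fin n → Pred (Fin n) 0ℓ
    Straddles x j = ρ ⟨$⟩ˡ x Fin.< j × after ρ j < suc (toℕ x) × suc (toℕ x) < letter ρ j

    Straddles? : ∀ x → Decidable (Straddles x)
    Straddles? x j = (ρ ⟨$⟩ˡ x Fin.<? j)
                     ×-dec (after ρ j <? suc (toℕ x)) ×-dec (suc (toℕ x) <? letter ρ j)

    straddling : Fin n → List (Fin n)
    straddling x = filter (Straddles? x) (allFin n)

    straddles : ∀ {x j} → j ∈ straddling x → Straddles x j
    straddles {x} j∈ = proj₂ (∈-filter⁻ (Straddles? x) {xs = allFin n} j∈)

    straddling-unique : ∀ x → Unique (straddling x)
    straddling-unique x = Unique.filter⁺ (Straddles? x) (Unique.allFin⁺ n)

    tail-∈ : ∀ {R : Fin n → Fin n → Set} {xs} → AllPairs R xs →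
             (∀ {y z} → R y z → ¬ R z y) → ∀ u x v → xs ≡ u ++ x ∷ v →
             ∀ {y} → y ∈ xs → R x y → y ∈ v
    tail-∈ ap asym u x v refl y∈ Rxy with ∈-++⁻ u y∈
    ... | inj₁ y∈u         = ⊥-elim (asym Rxy (AllPairs-left u ap y∈u))
    ... | inj₂ (here refl) = ⊥-elim (asym Rxy Rxy)
    ... | inj₂ (there y∈v) = y∈v

    tops-bound : ∀ u x v → descentTops ρ ≡ u ++ x ∷ v → c ρ x ≤ length v
    tops-bound u x v eq = pigeonhole {R = λ j b → b ≡ ρ ⟨$⟩ʳ j} (straddling-unique x)
      (λ {j} j∈ → let _ , lo , hi = straddles j∈ in
        ρ ⟨$⟩ʳ j ,
        tail-∈ tops-sorted (λ p q → ℕ.<-asym p q) u x v eq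
          (∈-filter⁺ (DescentTop? ρ) (∈-allFin _)
            (subst (λ k → after ρ k < letter ρ k) (sym (inverseˡ ρ)) (ℕ.<-trans lo hi)))
          (s≤s⁻¹ hi) ,
        refl)
      (λ _ _ p q → trans (sym (inverseˡ ρ))
                     (trans (cong (ρ ⟨$⟩ˡ_) (trans (sym p) q)) (inverseˡ ρ)))

    successor : ∀ i → after ρ i < letter ρ i →
                ∃[ i′ ] toℕ i′ ≡ suc (toℕ i) × after ρ i ≡ letter ρ i′
    successor i des with suc (toℕ i) <? n
    ... | yes p = fromℕ< p , Fin.toℕ-fromℕ< p , refl
    ... | no  _ = ⊥-elim (ℕ.<-asym (s≤s⁻¹ des) (Fin.toℕ<n (ρ ⟨$⟩ʳ i)))

    -- The end of the maximal descending run through position i.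
    runEnd : ∀ d i → n ≤ d + toℕ i →
             ∃[ k ] i Fin.≤ k × ¬ (after ρ k < letter ρ k) ×
                    (∀ l → i Fin.≤ l → l Fin.≤ k → letter ρ l ≤ letter ρ i)
    runEnd zero    i n≤ = ⊥-elim (ℕ.<⇒≱ (Fin.toℕ<n i) n≤)
    runEnd (suc d) i n≤ with after ρ i <? letter ρ i
    ... | no ¬des = i , ℕ.≤-refl , ¬des ,
                    λ l i≤l l≤i → ℕ.≤-reflexive (cong (letter ρ) (Fin.≤-antisym l≤i i≤l))
    ... | yes des
      with i′ , i′≡ , after≡ ← successor i des
      with k , i′≤k , ¬des , low ←
             runEnd d i′ (subst (n ≤_) (trans (sym (ℕ.+-suc d _)) (cong (d +_) (sym i′≡))) n≤)
      = k , ℕ.≤-trans (ℕ.n≤1+n _) (subst (_≤ toℕ k) i′≡ i′≤k) , ¬des , low′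
      where
      low′ : ∀ l → i Fin.≤ l → l Fin.≤ k → letter ρ l ≤ letter ρ i
      low′ l i≤l l≤k with ℕ.m≤n⇒m<n∨m≡n i≤l
      ... | inj₁ i<l = ℕ.≤-trans (low l (subst (_≤ toℕ l) (sym i′≡) i<l) l≤k)
                                 (subst (_≤ letter ρ i) after≡ (ℕ.<⇒≤ des))
      ... | inj₂ i≡l = ℕ.≤-reflexive (cong (letter ρ) (sym (Fin.toℕ-injective i≡l)))

    nontops-bound : ∀ u x v → reverse (nondescentTops ρ) ≡ u ++ x ∷ v → c ρ x ≤ length v
    nontops-bound u x v eq = pigeonhole {R = Below} (straddling-unique x) image inj
      where
      Below : Fin n → Fin n → Set
      Below j b = j Fin.< ρ ⟨$⟩ˡ b ×
                  (∀ l → j Fin.< l → l Fin.≤ ρ ⟨$⟩ˡ b → letter ρ l < suc (toℕ x))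

      image : ∀ {j} → j ∈ straddling x → ∃[ b ] b ∈ v × Below j b
      image {j} j∈
        with _ , lo , hi ← straddles j∈
        with j′ , j′≡ , after≡ ← successor j (ℕ.<-trans lo hi)
        with k , j′≤k , ¬des , low ← runEnd n j′ (ℕ.m≤m+n n _) =
        ρ ⟨$⟩ʳ k ,
        tail-∈ nontops-sorted (λ p q → ℕ.<-asym p q) u x v eq
          (∈-resp-↭ (↭-sym (↭-reverse _)) (∈-filter⁺ (∁? (DescentTop? ρ)) (∈-allFin _)
            (subst (λ k → ¬ (after ρ k < letter ρ k)) (sym (inverseˡ ρ)) ¬des)))
          (s≤s⁻¹ (below k (subst (_≤ toℕ k) j′≡ j′≤k) ℕ.≤-refl)) ,
        subst (λ k → j Fin.< k × (∀ l → j Fin.< l → l Fin.≤ k → letter ρ l < suc (toℕ x)))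
          (sym (inverseˡ ρ)) (subst (_≤ toℕ k) j′≡ j′≤k , below)
        where
        below : ∀ l → j Fin.< l → l Fin.≤ k → letter ρ l < suc (toℕ x)
        below l j<l l≤k = ℕ.≤-<-trans (low l (subst (_≤ toℕ l) (sym j′≡) j<l) l≤k)
                                      (subst (_< suc (toℕ x)) after≡ lo)

      inj : ∀ {i j b} → i ∈ straddling x → j ∈ straddling x → Below i b → Below j b → i ≡ j
      inj {i} {j} i∈ j∈ (i<b , i-low) (j<b , j-low) with Fin.<-cmp i j
      ... | tri≈ _ i≡j _ = i≡j
      ... | tri< i<j _ _ = ⊥-elim (ℕ.<-asym (i-low j i<j (ℕ.<⇒≤ j<b)) (proj₂ (proj₂ (straddles j∈))))
      ... | tri> _ _ j<i = ⊥-elim (ℕ.<-asym (j-low i j<i (ℕ.<⇒≤ i<b)) (proj₂ (proj₂ (straddles i∈))))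

  reverse-∷ : ∀ {A : Set} (u : List A) x v → reverse (u ++ x ∷ v) ≡ reverse v ++ x ∷ reverse u
  reverse-∷ u x v = begin
    reverse (u ++ x ∷ v)              ≡⟨ List.reverse-++ u (x ∷ v) ⟩
    reverse (x ∷ v) ++ reverse u      ≡⟨ cong (_++ reverse u) (List.unfold-reverse x v) ⟩
    (reverse v ++ [ x ]) ++ reverse u ≡⟨ List.++-assoc (reverse v) [ x ] (reverse u) ⟩
    reverse v ++ x ∷ reverse u        ∎
    where open ≡-Reasoning

  swap-reverse : ∀ {A : Set} {w w′ : List A} → reverse w ≡ w′ → w ≡ reverse w′
  swap-reverse {w = w} eq = trans (sym (List.reverse-involutive w)) (cong reverse eq)

  filter-reverse : ∀ {A : Set} {P : Pred A 0ℓ} (P? : Decidable P) w →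
                   length (filter P? (reverse w)) ≡ length (filter P? w)
  filter-reverse P? w = ↭-length (filter-↭ P? (↭-reverse w))

  Φ-column : ∀ {n} (ρ : Permutation′ n) i j → toℕ i ≡ toℕ j →
             Φ ρ ⟨$⟩ʳ lookup (bottomRow ρ) j ≡ lookup (topRow ρ) i
  Φ-column ρ i j i≡j = cong (lookup (topRow ρ)) (Fin.toℕ-injective
    (trans (Fin.toℕ-cast (rows-length ρ) _)
      (trans (cong toℕ (inverseˡ (wordPermutation (bottomRow ρ) (bottomRow-↭ ρ)))) (sym i≡j))))

Φ-correct : (ρ : Permutation′ n) → IsΦ ρ (Φ ρ)
Φ-correct ρ = record
  { f′      = arrangedDescentTops ρ
  ; g′      = arrangedNondescentTops ρ
  ; f′-arr  = arrangedDescentTops-↭ ρ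
  ; g′-arr  = arrangedNondescentTops-↭ ρ
  ; f′-code = Larger.arrange-code (c ρ) tops-sorted tops-bound
  ; g′-code = λ u x v eq →
      trans (sym (filter-reverse (Fin._<? x) v))
        (Smaller.arrange-code (c ρ) nontops-sorted nontops-bound (reverse v) x (reverse u)
          (trans (swap-reverse eq) (reverse-∷ u x v)))
  ; columns = λ p → let i , j , i≡j , i↦a , j↦b = zip⁻ (topRow ρ) (bottomRow ρ) p in
      trans (cong (Φ ρ ⟨$⟩ʳ_) (sym j↦b)) (trans (Φ-column ρ i j i≡j) i↦a)
  }
  where open Bounds ρ

Φ-unique : (ρ τ : Permutation′ n) → IsΦ ρ τ → τ ≈ Φ ρ
Φ-unique ρ τ isΦ b = begin
  τ ⟨$⟩ʳ b                          ≡⟨ cong (τ ⟨$⟩ʳ_) b-bottom ⟨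
  τ ⟨$⟩ʳ lookup (bottomRow ρ) j     ≡⟨ columns (subst₂ (λ f g → (lookup (topRow ρ) i , lookup (bottomRow ρ) j) ∈
                                                         zip (topRow ρ) (f ++ g))
                                          (sym f′≡) (sym g′≡)
                                          (zip⁺ (topRow ρ) (bottomRow ρ) i j i≡j)) ⟩
  lookup (topRow ρ) i               ≡⟨ Φ-column ρ i j i≡j ⟨
  Φ ρ ⟨$⟩ʳ lookup (bottomRow ρ) j   ≡⟨ cong (Φ ρ ⟨$⟩ʳ_) b-bottom ⟩
  Φ ρ ⟨$⟩ʳ b                        ∎
  where
  open ≡-Reasoning
  open IsΦ isΦ
  open Bounds ρ
  bottom   = wordPermutation (bottomRow ρ) (bottomRow-↭ ρ)
  j        = bottom ⟨$⟩ˡ b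
  i        = Fin.cast (rows-length ρ) j
  i≡j      = Fin.toℕ-cast (rows-length ρ) j
  b-bottom = inverseʳ bottom {b}
  f′≡ : f′ ≡ arrangedDescentTops ρ
  f′≡ = Larger.arrange-unique (c ρ) tops-sorted f′-arr f′-code
  g′≡ : g′ ≡ arrangedNondescentTops ρ
  g′≡ = swap-reverse (Smaller.arrange-unique (c ρ) nontops-sorted
          (↭-trans (↭-reverse g′) (↭-trans g′-arr (↭-sym (↭-reverse _))))
          λ u x v eq → trans (sym (filter-reverse (Fin._<? x) u))
                         (g′-code (reverse v) x (reverse u)
                           (trans (swap-reverse eq) (reverse-∷ u x v))))

{-# OPTIONS --safe #-}
module Submission where

-- If σ avoids 231 then every c(x) is 0, so f′ and g′ are increasing and Φ σ is the only permutation
-- that maps the descent tops increasingly onto the descent bottoms and their complements increasingly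
-- onto each other. Hence Φ σ avoids 321 and its drops are the descent tops, and the descents of σ and
-- the drops of Φ σ cross every level equally often; the statistics are read off from tops, bottoms and
-- these crossing numbers. Conversely, tops and crossing numbers determine σ: for x < y, the letter y
-- precedes x iff y is a top and no level between x and y has fewer crossings than the level of y.
-- For the drops of any 321-avoiding permutation the same rule defines a linear order on the letters,
-- and the word in this order is the preimage under Φ.

open import Defs
open import Data.Bool.Base using (if_then_else_)
open import Data.Empty using (⊥; ⊥-elim)
open import Data.Fin.Base as Fin using (Fin; zero; suc; toℕ; fromℕ<; inject₁)
import Data.Fin.Properties as Fin
open import Data.Fin.Permutation
  using (Permutation′; permutation; _⟨$⟩ʳ_; _⟨$⟩ˡ_; _≈_; flip; inverseˡ; inverseʳ)
open import Data.List.Base using (List; []; _∷_; _++_; allFin; filter; length; lookup; map; tabulate; zip)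
import Data.List.Properties as List
open import Data.List.Membership.Propositional using (_∈_)
open import Data.List.Membership.Propositional.Properties
  using (∈-allFin; ∈-filter⁺; ∈-filter⁻; ∈-length; ∈-lookup; ∈-∃++)
open import Data.List.Relation.Binary.Permutation.Propositional using (_↭_; ↭-sym)
open import Data.List.Relation.Binary.Permutation.Propositional.Properties using (∈-resp-↭; ↭-length)
open import Data.List.Relation.Unary.All as All using (All; []; _∷_)
open import Data.List.Relation.Unary.AllPairs as AllPairs using (AllPairs; []; _∷_)
import Data.List.Relation.Unary.AllPairs.Properties as AllPairs
open import Data.List.Relation.Unary.Any using (here; there; index)
open import Data.List.Relation.Unary.Any.Properties using (lookup-index)
open import Data.List.Relation.Unary.Unique.Propositional using (Unique)
import Data.List.Relation.Unary.Unique.Propositional.Properties as Unique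
open import Data.Nat.Base using (ℕ; zero; suc; _+_; _∸_; _≤_; _<_; _≥_; z≤n; s≤s; s≤s⁻¹)
import Data.Integer.Properties as ℤ
import Data.Nat.ListAction as ListAction
open import Data.Nat.Properties as ℕ using (_<?_; _≤?_)
open import Data.Product.Base using (Σ-syntax; _×_; _,_; _,′_; proj₁; proj₂; ∃-syntax)
open import Data.Sum.Base using (_⊎_; inj₁; inj₂; [_,_]′)
open import Function.Base using (_∘_; id)
open import Function.Bundles using (Bijection)
open import Level using (0ℓ)
open import Relation.Binary.Definitions using (tri<; tri≈; tri>)
open import Relation.Binary.PropositionalEquality
open import Relation.Nullary using (¬_; Dec; yes; no; does; contradiction)
open import Relation.Nullary.Decidable using (_×-dec_; _⊎-dec_; _→-dec_; ¬?; map′; decidable-stable)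
open import Relation.Unary using (Pred; Decidable; ∁)
open import Relation.Unary.Properties using (∁?)

open import Algebra.Properties.CommutativeMonoid.Sum ℕ.+-0-commutativeMonoid
  using (sum; sum-cong-≗; sum-permute; ∑-comm; ∑-distrib-+)

-- Everything rests on one identity. In a system of arcs whose lower ends are the elements of B and
-- whose upper ends are those of T, the number of arcs over a level is the number of elements of B
-- below it minus that of T, however the ends are paired. The descents of σ and the drops of `Φ σ`
-- are two such systems with the same ends but different pairings, so crossing numbers may be
-- computed in the word or in the permutation, as convenient. The comparison of levels comes from
-- 231-avoidance: descents over the level of a letter y lie weakly to the left of y. If a smaller x
-- stands to the right of y, each of them still provides a descent over every level between x and y;
-- if x stands to the left, the descent at y is missing at some level in between. For surjectivity
-- the obstacle is to identify the descent bottoms of the word built from τ. Only one inclusion is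
-- proved directly; the other follows by counting.

private
  variable
    n : ℕ

-- Counting

lookup-injective : {A : Set} {xs : List A} → Unique xs → ∀ i j → lookup xs i ≡ lookup xs j → i ≡ j
lookup-injective (px ∷ u) zero    zero    eq = refl
lookup-injective (px ∷ u) zero    (suc j) eq = contradiction eq (All.lookup px (∈-lookup j))
lookup-injective (px ∷ u) (suc i) zero    eq = contradiction (sym eq) (All.lookup px (∈-lookup i))
lookup-injective (px ∷ u) (suc i) (suc j) eq = cong suc (lookup-injective u i j eq)

indicator : {A : Set} → Dec A → ℕ
indicator a? = if does a? then 1 else 0

length-filter-tabulate : {A : Set} {P : Pred A 0ℓ} (P? : Decidable P) (f : Fin n → A) →
  length (filter P? (tabulate f)) ≡ sum (indicator ∘ P? ∘ f)
length-filter-tabulate {zero}  P? f = refl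
length-filter-tabulate {suc n} P? f with P? (f zero)
... | yes _ = cong suc (length-filter-tabulate P? (f ∘ suc))
... | no  _ = length-filter-tabulate P? (f ∘ suc)

#-sum : {P : Pred (Fin n) 0ℓ} (P? : Decidable P) → # P? ≡ sum (indicator ∘ P?)
#-sum P? = length-filter-tabulate P? id

sum-map-tabulate : {A : Set} (g : A → ℕ) (f : Fin n → A) →
  ListAction.sum (map g (tabulate f)) ≡ sum (g ∘ f)
sum-map-tabulate {zero}  g f = refl
sum-map-tabulate {suc n} g f = cong (g (f zero) +_) (sum-map-tabulate g (f ∘ suc))

-- The injection is given as a relation, so that the image may be chosen case by case inside a proof
-- and only uniqueness of the preimage remains to be checked.
#-injection : ∀ {m} {P : Pred (Fin m) 0ℓ} {Q : Pred (Fin n) 0ℓ} (P? : Decidable P) (Q? : Decidable Q)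
  (R : Fin m → Fin n → Set) → (∀ i → P i → ∃[ j ] Q j × R i j) →
  (∀ i i′ j → R i j → R i′ j → i ≡ i′) → # P? ≤ # Q?
#-injection {n} {m} {P} P? Q? R f inj = Fin.injective⇒≤ {f = g} g-injective
  where
  ps = filter P? (allFin m)
  qs = filter Q? (allFin n)
  P-lookup : ∀ k → P (lookup ps k)
  P-lookup k = proj₂ (∈-filter⁻ P? {xs = allFin m} (∈-lookup k))
  image : ∀ k → ∃[ j ] _ × R (lookup ps k) j
  image k = f (lookup ps k) (P-lookup k)
  image-∈ : ∀ k → proj₁ (image k) ∈ qs
  image-∈ k = ∈-filter⁺ Q? (∈-allFin _) (proj₁ (proj₂ (image k)))
  g : Fin (# P?) → Fin (# Q?)
  g k = index (image-∈ k)
  g-injective : ∀ {k l} → g k ≡ g l → k ≡ l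
  g-injective {k} {l} eq = lookup-injective (Unique.filter⁺ P? (Unique.allFin⁺ m)) k l
    (inj _ _ _ (proj₂ (proj₂ (image k))) (subst (R _) (sym images≡) (proj₂ (proj₂ (image l)))))
    where
    images≡ : proj₁ (image k) ≡ proj₁ (image l)
    images≡ = trans (lookup-index (image-∈ k))
                (trans (cong (lookup qs) eq) (sym (lookup-index (image-∈ l))))

#-mono : {P Q : Pred (Fin n) 0ℓ} (P? : Decidable P) (Q? : Decidable Q) →
  (∀ i → P i → Q i) → # P? ≤ # Q?
#-mono P? Q? f = #-injection P? Q? _≡_ (λ i p → i , f i p , refl) λ _ _ _ p q → trans p (sym q)

#-cong : {P Q : Pred (Fin n) 0ℓ} (P? : Decidable P) (Q? : Decidable Q) →
  (∀ i → P i → Q i) → (∀ i → Q i → P i) → # P? ≡ # Q?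
#-cong P? Q? f g = ℕ.≤-antisym (#-mono P? Q? f) (#-mono Q? P? g)

#-positive : {P : Pred (Fin n) 0ℓ} (P? : Decidable P) → ∀ i → P i → 0 < # P?
#-positive P? i p = ∈-length (∈-filter⁺ P? (∈-allFin i) p)

#-empty : {P : Pred (Fin n) 0ℓ} (P? : Decidable P) → (∀ i → ¬ P i) → # P? ≡ 0
#-empty P? f = cong length (List.filter-none P? {xs = allFin _} (All.tabulate λ {i} _ → f i))

#-⊎ : {P Q S : Pred (Fin n) 0ℓ} (P? : Decidable P) (Q? : Decidable Q) (S? : Decidable S) →
  (∀ i → S i → P i ⊎ Q i) → (∀ i → P i → S i) → (∀ i → Q i → S i) → (∀ i → P i → ¬ Q i) →
  # S? ≡ # P? + # Q?
#-⊎ P? Q? S? split p⇒s q⇒s disjoint = begin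
  # S?                                          ≡⟨ #-sum S? ⟩
  sum (indicator ∘ S?)                          ≡⟨ sum-cong-≗ pointwise ⟩
  sum (λ i → indicator (P? i) + indicator (Q? i)) ≡⟨ ∑-distrib-+ (indicator ∘ P?) (indicator ∘ Q?) ⟩
  sum (indicator ∘ P?) + sum (indicator ∘ Q?)   ≡⟨ cong₂ _+_ (#-sum P?) (#-sum Q?) ⟨
  # P? + # Q?                                   ∎
  where
  open ≡-Reasoning
  pointwise : ∀ i → indicator (S? i) ≡ indicator (P? i) + indicator (Q? i)
  pointwise i with S? i | P? i | Q? i
  ... | yes s | yes p | yes q = contradiction q (disjoint i p)
  ... | yes s | yes p | no ¬q = refl
  ... | yes s | no ¬p | yes q = refl
  ... | yes s | no ¬p | no ¬q = [ (λ p → contradiction p ¬p) , (λ q → contradiction q ¬q) ]′ (split i s)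
  ... | no ¬s | yes p | _     = contradiction (p⇒s i p) ¬s
  ... | no ¬s | no ¬p | yes q = contradiction (q⇒s i q) ¬s
  ... | no ¬s | no ¬p | no ¬q = refl

#-strict : {P Q : Pred (Fin n) 0ℓ} (P? : Decidable P) (Q? : Decidable Q) →
  (∀ i → P i → Q i) → ∀ i → Q i → ¬ P i → # P? < # Q?
#-strict P? Q? f i q ¬p = begin-strict
  # P?                                ≡⟨ ℕ.+-identityʳ _ ⟨
  # P? + 0                            <⟨ ℕ.+-monoʳ-< _ (#-positive (λ j → Q? j ×-dec ¬? (P? j)) i (q , ¬p)) ⟩
  # P? + # (λ j → Q? j ×-dec ¬? (P? j)) ≡⟨ #-⊎ P? _ Q? split f (λ _ → proj₁) (λ _ p q → proj₂ q p) ⟨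
  # Q?                                ∎
  where
  open ℕ.≤-Reasoning
  split : ∀ j → _ → _
  split j q with P? j
  ... | yes p = inj₁ p
  ... | no ¬p = inj₂ (q , ¬p)

#-full⇒⊇ : {P Q : Pred (Fin n) 0ℓ} (P? : Decidable P) (Q? : Decidable Q) →
  (∀ i → P i → Q i) → # Q? ≤ # P? → ∀ i → Q i → P i
#-full⇒⊇ P? Q? f le i q with P? i
... | yes p = p
... | no ¬p = contradiction (#-strict P? Q? f i q ¬p) (ℕ.≤⇒≯ le)

#-reindex : (π : Permutation′ n) {P : Pred (Fin n) 0ℓ} (P? : Decidable P) →
  # P? ≡ # (λ i → P? (π ⟨$⟩ʳ i))
#-reindex π P? =
  trans (#-sum P?) (trans (sum-permute (indicator ∘ P?) π) (sym (#-sum λ i → P? (π ⟨$⟩ʳ i))))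

#-singleton : (i : Fin n) → # (Fin._≟ i) ≡ 1
#-singleton i = ℕ.≤-antisym
  (#-injection {n = 1} (Fin._≟ i) (Fin._≟ zero) (λ j _ → j ≡ i) (λ j p → zero , refl , p) λ _ _ _ p q → trans p (sym q))
  (#-positive (Fin._≟ i) i refl)

#-initial : (i : Fin n) → # (λ (j : Fin n) → j Fin.<? i) ≡ toℕ i
#-initial {n} i = trans (#-sum (λ (j : Fin n) → j Fin.<? i)) (go i)
  where
  zeros : ∀ n → sum {n} (λ j → 0) ≡ 0
  zeros zero    = refl
  zeros (suc n) = zeros n
  go : ∀ {n} (i : Fin n) → sum (λ (j : Fin n) → indicator (j Fin.<? i)) ≡ toℕ i
  go {suc n} zero    = zeros n
  go {suc n} (suc i) = cong suc (go i)

-- Consecutive positions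

_⋖_ : Fin n → Fin n → Set
i ⋖ j = toℕ j ≡ suc (toℕ i)

⋖⇒< : {i j : Fin n} → i ⋖ j → i Fin.< j
⋖⇒< i⋖j = ℕ.≤-reflexive (sym i⋖j)

⋖-injectiveˡ : {i i′ j : Fin n} → i ⋖ j → i′ ⋖ j → i ≡ i′
⋖-injectiveˡ p q = Fin.toℕ-injective (ℕ.suc-injective (trans (sym p) q))

⋖-injectiveʳ : {i j j′ : Fin n} → i ⋖ j → i ⋖ j′ → j ≡ j′
⋖-injectiveʳ p q = Fin.toℕ-injective (trans p (sym q))

⋖-below : {i j k : Fin n} → i ⋖ j → k Fin.< j → k Fin.≤ i
⋖-below {k = k} i⋖j k<j = s≤s⁻¹ (subst (toℕ k <_) i⋖j k<j)

⋖-above : {i j k : Fin n} → i ⋖ j → i Fin.< k → j Fin.≤ k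
⋖-above {k = k} i⋖j i<k = subst (_≤ toℕ k) (sym i⋖j) i<k

next : {i j : Fin n} → i Fin.< j → ∃[ k ] i ⋖ k × k Fin.≤ j
next {j = j} i<j = k , i⋖k , ⋖-above {j = k} i⋖k i<j
  where
  k = fromℕ< (ℕ.≤-<-trans i<j (Fin.toℕ<n j))
  i⋖k = Fin.toℕ-fromℕ< _

-- A discrete intermediate value principle, applied below both to positions and to letters.
crossing : {P : Pred (Fin n) 0ℓ} → Decidable P → ∀ {i j} → i Fin.< j → P i → ¬ P j →
  ∃[ k ] ∃[ l ] k ⋖ l × i Fin.≤ k × l Fin.≤ j × P k × ¬ P l
crossing {n} {P} P? {i} {j} i<j pi ¬pj = go (toℕ j) i (ℕ.m≤n+m (toℕ j) (toℕ i)) i<j pi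
  where
  -- `d` bounds the remaining distance from `k` to `j` and makes the recursion structural.
  go : ∀ d k → toℕ j ≤ toℕ k + d → k Fin.< j → P k →
       ∃[ k′ ] ∃[ l ] k′ ⋖ l × k Fin.≤ k′ × l Fin.≤ j × P k′ × ¬ P l
  go zero    k j≤ k<j pk = contradiction (ℕ.<-≤-trans k<j (subst (toℕ j ≤_) (ℕ.+-identityʳ _) j≤)) (ℕ.<-irrefl refl)
  go (suc d) k j≤ k<j pk = let l , k⋖l , l≤j = next k<j in step l k⋖l l≤j (P? l)
    where
    step : ∀ l → k ⋖ l → l Fin.≤ j → Dec (P l) →
           ∃[ k′ ] ∃[ l ] k′ ⋖ l × k Fin.≤ k′ × l Fin.≤ j × P k′ × ¬ P l
    step l k⋖l l≤j (no ¬pl) = k , l , k⋖l , ℕ.≤-refl , l≤j , pk , ¬pl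
    step l k⋖l l≤j (yes pl)
      with k′ , l′ , k′⋖l′ , l≤k′ , rest ← go d l
             (subst (toℕ j ≤_) (trans (ℕ.+-suc _ d) (cong (_+ d) (sym k⋖l))) j≤)
             (ℕ.≤∧≢⇒< l≤j λ l≡j → ¬pj (subst P (Fin.toℕ-injective l≡j) pl)) pl
      = k′ , l′ , k′⋖l′ , ℕ.≤-trans (ℕ.<⇒≤ (⋖⇒< k⋖l)) l≤k′ , rest

module _ (σ : Permutation′ n) where

  letter-injective : ∀ {i j} → letter σ i ≡ letter σ j → i ≡ j
  letter-injective eq = trans (sym (inverseˡ σ))
    (trans (cong (σ ⟨$⟩ˡ_) (Fin.toℕ-injective (ℕ.suc-injective eq))) (inverseˡ σ))

  ʳ-injective : ∀ {i j} → σ ⟨$⟩ʳ i ≡ σ ⟨$⟩ʳ j → i ≡ j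
  ʳ-injective eq = letter-injective (cong (suc ∘ toℕ) eq)

  letter-position : ∀ x → letter σ (σ ⟨$⟩ˡ x) ≡ suc (toℕ x)
  letter-position x = cong (suc ∘ toℕ) (inverseʳ σ)

  ext-letter : ∀ j → ext σ (suc (toℕ j)) ≡ letter σ j
  ext-letter j with toℕ j <? n
  ... | yes p = cong (letter σ) (Fin.fromℕ<-toℕ j p)
  ... | no ¬p = contradiction (Fin.toℕ<n j) ¬p

  after-⋖ : ∀ {i j} → i ⋖ j → after σ i ≡ letter σ j
  after-⋖ {j = j} i⋖j = trans (cong (ext σ ∘ suc) (sym i⋖j)) (ext-letter j)

  before-⋖ : ∀ {i j} → i ⋖ j → before σ j ≡ letter σ i
  before-⋖ {i} i⋖j = trans (cong (ext σ) i⋖j) (ext-letter i)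

  -- Only the last position has `after` equal to n + 1, the code of ∞.
  after≤⇒⋖ : ∀ {i} → after σ i ≤ n → ∃[ j ] i ⋖ j × after σ i ≡ letter σ j
  after≤⇒⋖ {i} a≤n with suc (toℕ i) <? n
  ... | yes p = fromℕ< p , Fin.toℕ-fromℕ< p , refl
  ... | no  _ = contradiction a≤n (ℕ.<⇒≱ ℕ.≤-refl)

  descent⇒⋖ : ∀ {i} → after σ i < letter σ i → ∃[ j ] i ⋖ j × σ ⟨$⟩ʳ j Fin.< σ ⟨$⟩ʳ i
  descent⇒⋖ {i} lt with j , i⋖j , eq ← after≤⇒⋖ (ℕ.≤-trans (ℕ.<⇒≤ lt) (Fin.toℕ<n (σ ⟨$⟩ʳ i))) =
    j , i⋖j , s≤s⁻¹ (subst (_< letter σ i) eq lt)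

  ⋖⇒descent : ∀ {i j} → i ⋖ j → σ ⟨$⟩ʳ j Fin.< σ ⟨$⟩ʳ i → after σ i < letter σ i
  ⋖⇒descent {i} i⋖j lt = subst (_< letter σ i) (sym (after-⋖ i⋖j)) (s≤s lt)

  first⊎⋖ : ∀ j → before σ j ≡ 0 ⊎ ∃[ i ] i ⋖ j × before σ j ≡ letter σ i
  first⊎⋖ zero    = inj₁ refl
  first⊎⋖ (suc j) = inj₂ (inject₁ j , i⋖j , before-⋖ i⋖j)
    where
    i⋖j : inject₁ j ⋖ suc j
    i⋖j = cong suc (sym (Fin.toℕ-inject₁ j))

  descent⇒⋖ˡ : ∀ {j} → letter σ j < before σ j → ∃[ i ] i ⋖ j × σ ⟨$⟩ʳ j Fin.< σ ⟨$⟩ʳ i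
  descent⇒⋖ˡ {j} lt with first⊎⋖ j
  ... | inj₁ eq             = contradiction (subst (letter σ j <_) eq lt) ℕ.n≮0
  ... | inj₂ (i , i⋖j , eq) = i , i⋖j , s≤s⁻¹ (subst (letter σ j <_) eq lt)

  ⋖⇒descentˡ : ∀ {i j} → i ⋖ j → σ ⟨$⟩ʳ j Fin.< σ ⟨$⟩ʳ i → letter σ j < before σ j
  ⋖⇒descentˡ {i} {j} i⋖j lt = subst (letter σ j <_) (sym (before-⋖ i⋖j)) (s≤s lt)

  before≢letter : ∀ i → before σ i ≢ letter σ i
  before≢letter j eq with first⊎⋖ j
  ... | inj₁ eq′            = contradiction (trans (sym eq′) eq) λ()
  ... | inj₂ (i , i⋖j , eq′) =
    ℕ.<⇒≢ (⋖⇒< i⋖j) (cong toℕ (letter-injective (trans (sym eq′) eq)))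

  after≢letter : ∀ i → after σ i ≢ letter σ i
  after≢letter i eq with j , i⋖j , eq′ ← after≤⇒⋖ {i} (ℕ.≤-trans (ℕ.≤-reflexive eq) (Fin.toℕ<n _)) =
    ℕ.<⇒≢ (⋖⇒< i⋖j) (cong toℕ (letter-injective (trans (sym eq) eq′)))

  descentTop⁺ : ∀ {i} → after σ i < letter σ i → DescentTop σ (σ ⟨$⟩ʳ i)
  descentTop⁺ {i} = subst (λ k → after σ k < letter σ k) (sym (inverseˡ σ))

  descentTop⁻ : ∀ {i} → DescentTop σ (σ ⟨$⟩ʳ i) → after σ i < letter σ i
  descentTop⁻ = subst (λ k → after σ k < letter σ k) (inverseˡ σ)

  descentBottom⁺ : ∀ {i} → letter σ i < before σ i → DescentBottom σ (σ ⟨$⟩ʳ i)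
  descentBottom⁺ = subst (λ k → letter σ k < before σ k) (sym (inverseˡ σ))

  descentBottom⁻ : ∀ {i} → DescentBottom σ (σ ⟨$⟩ʳ i) → letter σ i < before σ i
  descentBottom⁻ = subst (λ k → letter σ k < before σ k) (inverseˡ σ)

-- Permutations increasing on a set and on its complement

-- At `toℕ x` with x in P this is the rank of x in P, starting from 0. The bound is a natural number
-- so that the top level n is available.
below : {P : Pred (Fin n) 0ℓ} → Decidable P → ℕ → ℕ
below P? k = # λ x → P? x ×-dec (toℕ x <? k)

module _ {P : Pred (Fin n) 0ℓ} (P? : Decidable P) where

  below-mono : ∀ {k l} → k ≤ l → below P? k ≤ below P? l
  below-mono k≤l = #-mono {n = n} _ _ λ _ (p , lt) → p , ℕ.<-≤-trans lt k≤l

  below-strict : ∀ {x l} → P x → toℕ x < l → below P? (toℕ x) < below P? l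
  below-strict {x} p x<l = #-strict _ _ (λ _ (q , lt) → q , ℕ.<-trans lt x<l) x (p , x<l)
    λ (_ , x<x) → ℕ.<-irrefl refl x<x

  below-injective : ∀ {x y} → P x → P y → below P? (toℕ x) ≡ below P? (toℕ y) → x ≡ y
  below-injective {x} {y} px py eq with Fin.<-cmp x y
  ... | tri< x<y _ _ = contradiction eq (ℕ.<⇒≢ (below-strict px x<y))
  ... | tri≈ _ x≡y _ = x≡y
  ... | tri> _ _ y<x = contradiction (sym eq) (ℕ.<⇒≢ (below-strict py y<x))

  below-∁ : ∀ k → # (λ (x : Fin n) → toℕ x <? k) ≡ below P? k + below (∁? P?) k
  below-∁ k = #-⊎ _ _ _ split (λ _ → proj₂) (λ _ → proj₂) (λ _ p q → proj₁ q (proj₁ p))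
    where
    split : ∀ x → _ → _
    split x lt with P? x
    ... | yes p = inj₁ (p , lt)
    ... | no ¬p = inj₂ (¬p , lt)

-- Used in two ways: T and B are the descent tops and bottoms of a 231-avoiding σ with τ its image,
-- or the drops and drop values of a 321-avoiding τ.
record Monotone (T B : Pred (Fin n) 0ℓ) (τ : Permutation′ n) : Set where
  field
    image         : ∀ {b} → T b → B (τ ⟨$⟩ʳ b)
    image⁻        : ∀ {b} → B (τ ⟨$⟩ʳ b) → T b
    mono          : ∀ {a b} → T a → T b → a Fin.< b → τ ⟨$⟩ʳ a Fin.< τ ⟨$⟩ʳ b
    mono-∁        : ∀ {a b} → ¬ T a → ¬ T b → a Fin.< b → τ ⟨$⟩ʳ a Fin.< τ ⟨$⟩ʳ b

open Monotone

module _ {T B : Pred (Fin n) 0ℓ} (T? : Decidable T) where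

  Monotone-∁ : ∀ {τ} → Monotone T B τ → Monotone (∁ T) (∁ B) τ
  Monotone-∁ m = record
    { image  = λ ¬t b → ¬t (image⁻ m b)
    ; image⁻ = λ ¬b t → ¬b (image m t)
    ; mono   = mono-∁ m
    ; mono-∁ = λ ¬¬s ¬¬t → mono m (decidable-stable (T? _) ¬¬s) (decidable-stable (T? _) ¬¬t)
    }

  Monotone-cmp : ∀ {τ} → Monotone T B τ → ∀ {a b} → T a → T b →
                 τ ⟨$⟩ʳ a Fin.< τ ⟨$⟩ʳ b → a Fin.< b
  Monotone-cmp {τ} m {a} {b} s t lt with Fin.<-cmp a b
  ... | tri< a<b _ _  = a<b
  ... | tri≈ _ refl _ = contradiction lt (ℕ.<-irrefl refl)
  ... | tri> _ _ b<a  = contradiction lt (ℕ.<⇒≯ (mono m t s b<a))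

  module _ (B? : Decidable B) where

    rank : ∀ {τ} → Monotone T B τ → ∀ {b} → T b → below B? (toℕ (τ ⟨$⟩ʳ b)) ≡ below T? (toℕ b)
    rank {τ} m t = trans (#-reindex τ _) (#-cong {n = n} _ _
      (λ _ (q , lt) → image⁻ m q , Monotone-cmp m (image⁻ m q) t lt)
      (λ _ (s , lt) → image m s , mono m s t lt))

    Monotone-unique-on : ∀ {τ υ} → Monotone T B τ → Monotone T B υ →
                         ∀ {b} → T b → τ ⟨$⟩ʳ b ≡ υ ⟨$⟩ʳ b
    Monotone-unique-on m m′ t =
      below-injective B? (image m t) (image m′ t) (trans (rank m t) (sym (rank m′ t)))

Monotone-unique : {T B : Pred (Fin n) 0ℓ} (T? : Decidable T) (B? : Decidable B) {τ υ : Permutation′ n} →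
                  Monotone T B τ → Monotone T B υ → τ ≈ υ
Monotone-unique T? B? m m′ b with T? b
... | yes t = Monotone-unique-on T? B? m m′ t
... | no ¬t = Monotone-unique-on (∁? T?) (∁? B?) (Monotone-∁ T? m) (Monotone-∁ T? m′) ¬t

Monotone-resp : {T B T′ B′ : Pred (Fin n) 0ℓ} {τ : Permutation′ n} →
  (∀ x → T x → T′ x) → (∀ x → T′ x → T x) → (∀ x → B x → B′ x) → (∀ x → B′ x → B x) →
  Monotone T B τ → Monotone T′ B′ τ
Monotone-resp t t⁻ b b⁻ m = record
  { image  = λ p → b _ (image m (t⁻ _ p))
  ; image⁻ = λ p → t _ (image⁻ m (b⁻ _ p))
  ; mono   = λ p q → mono m (t⁻ _ p) (t⁻ _ q)
  ; mono-∁ = λ p q → mono-∁ m (λ r → p (t _ r)) (λ r → q (t _ r))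
  }

below-all : {P : Pred (Fin n) 0ℓ} (P? : Decidable P) → below P? n ≡ # P?
below-all {n} P? = #-cong {n = n} _ _ (λ _ → proj₁) λ x p → p , Fin.toℕ<n x

below-∁-cong : {P Q : Pred (Fin n) 0ℓ} (P? : Decidable P) (Q? : Decidable Q) → ∀ k →
  below P? k ≡ below Q? k → below (∁? P?) k ≡ below (∁? Q?) k
below-∁-cong P? Q? k eq = ℕ.+-cancelˡ-≡ (below Q? k) _ _
  (trans (cong (_+ below (∁? P?) k) (sym eq)) (trans (sym (below-∁ P? k)) (below-∁ Q? k)))

-- Arcs: an index i stands for an arc from lo i to hi i if lo i < hi i, and for nothing otherwise.

cross : (lo hi : Fin n → ℕ) → ℕ → ℕ → ℕ
cross lo hi k m = # λ i → (lo i ≤? k) ×-dec (m <? hi i)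

record Arcs {T B : Pred (Fin n) 0ℓ} (T? : Decidable T) (B? : Decidable B) (lo hi : Fin n → ℕ) : Set where
  field
    opens  : ∀ k → # (λ i → (lo i <? hi i) ×-dec (lo i ≤? k)) ≡ below B? k
    closes : ∀ k → # (λ i → (lo i <? hi i) ×-dec (hi i ≤? k)) ≡ below T? k

  -- Each arc opening at or below k either ends by m or crosses. The bound m ≤ k + 1 ensures that an
  -- arc ending by m has opened by k.
  balance : ∀ {k m} → k ≤ m → m ≤ suc k → below B? k ≡ below T? m + cross lo hi k m
  balance {k} {m} k≤m m≤1+k = trans (sym (opens k)) (trans
    (#-⊎ {n = n} _ _ _ split
      (λ _ (arc , hi≤m) → arc , s≤s⁻¹ (ℕ.≤-trans arc (ℕ.≤-trans hi≤m m≤1+k)))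
      (λ _ (lo≤k , m<hi) → ℕ.≤-<-trans (ℕ.≤-trans lo≤k k≤m) m<hi , lo≤k)
      (λ _ (_ , hi≤m) (_ , m<hi) → ℕ.<⇒≱ m<hi hi≤m))
    (cong (_+ cross lo hi k m) (closes m)))
    where
    split : ∀ i → _ → _
    split i (arc , lo≤k) with hi i ≤? m
    ... | yes hi≤m = inj₁ (arc , hi≤m)
    ... | no  hi≰m = inj₂ (lo≤k , ℕ.≰⇒> hi≰m)

  -- Arc ends are 1-based and levels 0-based: for an arc between the letters a < b of `Fin n`,
  -- `over k` requires a < k ≤ b, which is the gap just below k, and `straddle k` requires a < k <
  -- b.
  over straddle : ℕ → ℕ
  over     k = cross lo hi k k
  straddle k = cross lo hi k (suc k)

  over-balance : ∀ k → below B? k ≡ below T? k + over k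
  over-balance k = balance ℕ.≤-refl (ℕ.n≤1+n k)

  straddle-balance : ∀ k → below B? k ≡ below T? (suc k) + straddle k
  straddle-balance k = balance (ℕ.n≤1+n k) ℕ.≤-refl

dropArcs : {T B : Pred (Fin n) 0ℓ} {T? : Decidable T} {B? : Decidable B} {τ : Permutation′ n} →
  (∀ {b} → T b → τ ⟨$⟩ʳ b Fin.< b) → (∀ {b} → τ ⟨$⟩ʳ b Fin.< b → T b) → Monotone T B τ →
  Arcs T? B? (letter τ) (suc ∘ toℕ)
dropArcs {n} {τ = τ} t⇒drop drop⇒t m = record
  { opens  = λ k → trans
      (#-cong {n = n} _ _ (λ _ (lt , le) → image m (drop⇒t (s≤s⁻¹ lt)) , le)
                          (λ _ (b , le) → s≤s (t⇒drop (image⁻ m b)) , le))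
      (sym (#-reindex τ _))
  ; closes = λ k → #-cong {n = n} _ _ (λ _ (lt , le) → drop⇒t (s≤s⁻¹ lt) , le)
                                      (λ _ (t , le) → s≤s (t⇒drop t) , le)
  }

module _ {T B : Pred (Fin n) 0ℓ} {T? : Decidable T} {B? : Decidable B} where

  -- By `balance`, both sides are the same difference of counts in B and T; the pairing of the ends
  -- has disappeared.
  cross-unique : ∀ {lo hi lo′ hi′} → Arcs T? B? lo hi → Arcs T? B? lo′ hi′ →
                 ∀ {k m} → k ≤ m → m ≤ suc k → cross lo hi k m ≡ cross lo′ hi′ k m
  cross-unique arcs arcs′ {k} {m} k≤m m≤1+k = ℕ.+-cancelˡ-≡ (below T? m) _ _
    (trans (sym (Arcs.balance arcs k≤m m≤1+k)) (Arcs.balance arcs′ k≤m m≤1+k))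

  module _ {lo hi} (arcs : Arcs T? B? lo hi) {τ} (m : Monotone T B τ) where
    open Arcs arcs

    -- Up to b there are at least as many elements of B below b as elements of T including b itself.
    -- So the element of B with the rank of b in T is already smaller than b.
    top⇒drop : ∀ {b} → T b → τ ⟨$⟩ʳ b Fin.< b
    top⇒drop {b} t = ℕ.≰⇒> λ b≤τb → ℕ.<-irrefl refl (begin-strict
      below B? (toℕ b)          ≤⟨ below-mono B? b≤τb ⟩
      below B? (toℕ (τ ⟨$⟩ʳ b)) ≡⟨ rank T? B? m t ⟩
      below T? (toℕ b)          <⟨ below-strict T? t ℕ.≤-refl ⟩
      below T? (suc (toℕ b))    ≤⟨ ℕ.m≤m+n _ _ ⟩
      _                         ≡⟨ straddle-balance (toℕ b) ⟨
      below B? (toℕ b)          ∎)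
      where open ℕ.≤-Reasoning

    private
      rank-∁ : ∀ {b} → ¬ T b → below (∁? B?) (toℕ (τ ⟨$⟩ʳ b)) ≡ below (∁? T?) (toℕ b)
      rank-∁ = rank (∁? T?) (∁? B?) (Monotone-∁ T? m)

    -- Dually, B has at least as many elements below b as T, hence its complement at most as many,
    -- and the value with the rank of b cannot come earlier than b.
    nontop⇒nondrop : ∀ {b} → ¬ T b → b Fin.≤ τ ⟨$⟩ʳ b
    nontop⇒nondrop {b} ¬t = ℕ.≮⇒≥ λ τb<b → ℕ.<-irrefl refl (ℕ.+-cancelˡ-< (below B? (toℕ b)) _ _ (begin-strict
      below B? (toℕ b) + below (∁? T?) (toℕ b)             ≡⟨ cong (below B? (toℕ b) +_) (rank-∁ ¬t) ⟨
      below B? (toℕ b) + below (∁? B?) (toℕ (τ ⟨$⟩ʳ b))    <⟨ ℕ.+-monoʳ-< _ (below-strict (∁? B?) (¬t ∘ image⁻ m) τb<b) ⟩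
      below B? (toℕ b) + below (∁? B?) (toℕ b)             ≡⟨ below-∁ B? (toℕ b) ⟨
      _                                                    ≡⟨ below-∁ T? (toℕ b) ⟩
      below T? (toℕ b) + below (∁? T?) (toℕ b)             ≤⟨ ℕ.+-monoˡ-≤ (below (∁? T?) (toℕ b)) (ℕ.m≤m+n (below T? (toℕ b)) (over (toℕ b))) ⟩
      below T? (toℕ b) + over (toℕ b) + below (∁? T?) (toℕ b) ≡⟨ cong (_+ below (∁? T?) (toℕ b)) (over-balance (toℕ b)) ⟨
      below B? (toℕ b) + below (∁? T?) (toℕ b)             ∎))
      where open ℕ.≤-Reasoning

    drop⇒top : ∀ {b} → τ ⟨$⟩ʳ b Fin.< b → T b
    drop⇒top τb<b = decidable-stable (T? _) λ ¬t → ℕ.<⇒≱ τb<b (nontop⇒nondrop ¬t)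

    dropValue⇒bottom : ∀ {x} → x Fin.< τ ⟨$⟩ˡ x → B x
    dropValue⇒bottom {x} lt = subst B (inverseʳ τ)
      (image m (drop⇒top (subst (Fin._< τ ⟨$⟩ˡ x) (sym (inverseʳ τ)) lt)))

    bottom⇒dropValue : ∀ {x} → B x → x Fin.< τ ⟨$⟩ˡ x
    bottom⇒dropValue {x} b = subst (Fin._< τ ⟨$⟩ˡ x) (inverseʳ τ)
      (top⇒drop (image⁻ m (subst B (sym (inverseʳ τ)) b)))

    -- A fixed x has equal ranks in the complements of T and B, so T and B have equally many
    -- elements below x, and their difference is `over (toℕ x)`.
    fixed⇒ : ∀ {x} → τ ⟨$⟩ʳ x ≡ x → ¬ T x × ¬ B x × over (toℕ x) ≡ 0
    fixed⇒ {x} eq = ¬t , ¬t ∘ image⁻ m ∘ subst B (sym eq) , over≡0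
      where
      ¬t : ¬ T x
      ¬t t = ℕ.<-irrefl (cong toℕ eq) (top⇒drop t)
      over≡0 : over (toℕ x) ≡ 0
      over≡0 = ℕ.+-cancelˡ-≡ (below T? (toℕ x)) _ _ (trans (sym (over-balance (toℕ x)))
        (trans (ℕ.+-cancelʳ-≡ (below (∁? T?) (toℕ x)) _ _ (begin
          below B? (toℕ x) + below (∁? T?) (toℕ x) ≡⟨ cong (below B? (toℕ x) +_) (rank-∁ ¬t) ⟨
          _                                        ≡⟨ cong (λ y → below B? (toℕ x) + below (∁? B?) (toℕ y)) eq ⟩
          _                                        ≡⟨ below-∁ B? (toℕ x) ⟨
          _                                        ≡⟨ below-∁ T? (toℕ x) ⟩
          _                                        ∎))
        (sym (ℕ.+-identityʳ _))))
        where open ≡-Reasoning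

    fixed⇐ : ∀ {x} → ¬ T x → ¬ B x → over (toℕ x) ≡ 0 → τ ⟨$⟩ʳ x ≡ x
    fixed⇐ {x} ¬t ¬b over≡0 = below-injective (∁? B?) (¬t ∘ image⁻ m) ¬b (trans (rank-∁ ¬t)
      (below-∁-cong T? B? (toℕ x) (sym (trans (over-balance (toℕ x))
        (trans (cong (below T? (toℕ x) +_) over≡0) (ℕ.+-identityʳ _))))))

    cross-drops : ∀ {k l} → k ≤ l → l ≤ suc k → cross lo hi k l ≡ cross (letter τ) (suc ∘ toℕ) k l
    cross-drops = cross-unique arcs (dropArcs {T? = T?} {B? = B?} top⇒drop drop⇒top m)
-- Arcs are indexed by the position of the descent top. Counting by lower ends therefore needs a
-- shift to the next position, where the descent bottom stands.
descentArcs : (σ : Permutation′ n) → Arcs (DescentTop? σ) (DescentBottom? σ) (after σ) (letter σ)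
descentArcs {n} σ = record
  { opens  = λ k → trans (ℕ.≤-antisym (starts≤ends k) (ends≤starts k)) (trans
      (#-cong {n = n} _ _ (λ _ (lt , le) → descentBottom⁺ σ lt , le) (λ _ (b , le) → descentBottom⁻ σ b , le))
      (sym (#-reindex σ _)))
  ; closes = λ k → trans
      (#-cong {n = n} _ _ (λ _ (lt , le) → descentTop⁺ σ lt , le) (λ _ (t , le) → descentTop⁻ σ t , le))
      (sym (#-reindex σ _))
  }
  where
  starts ends : ℕ → ℕ
  starts k = # λ i → (after σ i <? letter σ i) ×-dec (after σ i ≤? k)
  ends   k = # λ j → (letter σ j <? before σ j) ×-dec (letter σ j ≤? k)
  starts≤ends : ∀ k → starts k ≤ ends k
  starts≤ends k = #-injection {n = n} _ _ _⋖_
    (λ i (lt , le) → let j , i⋖j , desc = descent⇒⋖ σ lt in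
      j , (⋖⇒descentˡ σ i⋖j desc , subst (_≤ k) (after-⋖ σ i⋖j) le) , i⋖j)
    (λ _ _ _ → ⋖-injectiveˡ)
  ends≤starts : ∀ k → ends k ≤ starts k
  ends≤starts k = #-injection {n = n} _ _ (λ j i → i ⋖ j)
    (λ j (lt , le) → let i , i⋖j , desc = descent⇒⋖ˡ σ lt in
      i , (⋖⇒descent σ i⋖j desc , subst (_≤ k) (sym (after-⋖ σ i⋖j)) le) , i⋖j)
    (λ _ _ _ → ⋖-injectiveʳ)

below-bottoms : (σ : Permutation′ n) → below (DescentBottom? σ) n ≡ below (DescentTop? σ) n
below-bottoms {n} σ = trans (Arcs.over-balance (descentArcs σ) n) (trans
  (cong (below (DescentTop? σ) n +_) (#-empty {n = n} _ λ i (_ , n<) → ℕ.<⇒≱ n< (Fin.toℕ<n (σ ⟨$⟩ʳ i))))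
  (ℕ.+-identityʳ _))

-- The map Φ on 231-avoiding permutations

filter-empty : {A : Set} {P : Pred A 0ℓ} (P? : Decidable P) → ∀ xs → length (filter P? xs) ≡ 0 → All (∁ P) xs
filter-empty P? xs eq = All.tabulate λ y∈ p →
  ℕ.n≮0 (subst (0 <_) eq (∈-length (∈-filter⁺ P? y∈ p)))

module _ {A : Set} {R : A → A → Set} where

  prefixes⇒AllPairs : ∀ w → (∀ u x v → w ≡ u ++ x ∷ v → All (λ y → R y x) u) → AllPairs R w
  prefixes⇒AllPairs []      f = []
  prefixes⇒AllPairs (z ∷ w) f =
    All.tabulate (λ y∈ → let u , v , eq = ∈-∃++ y∈ in All.head (f (z ∷ u) _ v (cong (z ∷_) eq))) ∷
    prefixes⇒AllPairs w λ u x v eq → All.tail (f (z ∷ u) x v (cong (z ∷_) eq))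

  suffixes⇒AllPairs : ∀ w → (∀ u x v → w ≡ u ++ x ∷ v → All (R x) v) → AllPairs R w
  suffixes⇒AllPairs []      f = []
  suffixes⇒AllPairs (z ∷ w) f =
    f [] z w refl ∷ suffixes⇒AllPairs w λ u x v eq → f (z ∷ u) x v (cong (z ∷_) eq)

module _ {A B : Set} where

  ∈-zip : ∀ (xs : List A) (ys : List B) {b} → length ys ≤ length xs → b ∈ ys →
          ∃[ a ] a ∈ xs × (a , b) ∈ zip xs ys
  ∈-zip (x ∷ xs) (y ∷ ys) le (here refl) = x , here refl , here refl
  ∈-zip (x ∷ xs) (y ∷ ys) le (there b∈) with a , a∈ , ab∈ ← ∈-zip xs ys (s≤s⁻¹ le) b∈ =
    a , there a∈ , there ab∈

  ∈-zip⁻ : ∀ (xs : List A) (ys : List B) {a b} → (a , b) ∈ zip xs ys → a ∈ xs × b ∈ ys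
  ∈-zip⁻ (x ∷ xs) (y ∷ ys) (here refl) = here refl , here refl
  ∈-zip⁻ (x ∷ xs) (y ∷ ys) (there p) with a∈ , b∈ ← ∈-zip⁻ xs ys p = there a∈ , there b∈

  ∈-zip-++ˡ : ∀ (xs : List A) (ys : List B) {xs′ ys′ p} → p ∈ zip xs ys → p ∈ zip (xs ++ xs′) (ys ++ ys′)
  ∈-zip-++ˡ (x ∷ xs) (y ∷ ys) (here eq) = here eq
  ∈-zip-++ˡ (x ∷ xs) (y ∷ ys) (there p) = there (∈-zip-++ˡ xs ys p)

  ∈-zip-++ʳ : ∀ (xs : List A) (ys : List B) {xs′ ys′ p} → length xs ≡ length ys →
              p ∈ zip xs′ ys′ → p ∈ zip (xs ++ xs′) (ys ++ ys′)
  ∈-zip-++ʳ []       []       eq p = p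
  ∈-zip-++ʳ (x ∷ xs) (y ∷ ys) eq p = there (∈-zip-++ʳ xs ys (ℕ.suc-injective eq) p)

zip-mono : ∀ (xs ys : List (Fin n)) → AllPairs Fin._<_ xs → AllPairs Fin._≤_ ys →
  ∀ {a b a′ b′} → (a , b) ∈ zip xs ys → (a′ , b′) ∈ zip xs ys → b Fin.< b′ → a Fin.< a′
zip-mono (x ∷ xs) (y ∷ ys) (px ∷ _) (py ∷ _) (here refl) (here refl) lt = contradiction lt (ℕ.<-irrefl refl)
zip-mono (x ∷ xs) (y ∷ ys) (px ∷ _) (py ∷ _) (here refl) (there q)   lt = All.lookup px (proj₁ (∈-zip⁻ xs ys q))
zip-mono (x ∷ xs) (y ∷ ys) (px ∷ _) (py ∷ _) (there p)   (here refl) lt =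
  contradiction (All.lookup py (proj₂ (∈-zip⁻ xs ys p))) (ℕ.<⇒≱ lt)
zip-mono (x ∷ xs) (y ∷ ys) (_ ∷ sx) (_ ∷ sy) (there p)   (there q)   lt = zip-mono xs ys sx sy p q lt

filter-sorted : {P : Pred (Fin n) 0ℓ} (P? : Decidable P) → AllPairs Fin._<_ (filter P? (allFin n))
filter-sorted P? = AllPairs.filter⁺ P? (AllPairs.tabulate⁺-< λ i<j → i<j)

module _ {σ : Permutation′ n} (avoids : Avoids231 σ) where

  -- In other words, a descent that passes over a letter lies to the left of that letter.
  no231 : ∀ {i j} → i Fin.< j → after σ j < letter σ i → letter σ i < letter σ j → ⊥
  no231 {i} {j} i<j lo hi
    with k , j⋖k , after≡ ← after≤⇒⋖ σ {j} (ℕ.≤-trans (ℕ.<⇒≤ lo) (Fin.toℕ<n (σ ⟨$⟩ʳ i))) =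
    avoids (i , j , k , i<j , ⋖⇒< j⋖k , s≤s⁻¹ (subst (_< letter σ i) after≡ lo) , s≤s⁻¹ hi)

  c≡0 : ∀ x → c σ x ≡ 0
  c≡0 x = #-empty {n = n} _ λ j (i<j , lo , hi) → no231 i<j
    (subst (after σ j <_) (sym (letter-position σ x)) lo) (subst (_< letter σ j) (sym (letter-position σ x)) hi)

  IsΦ⇒Monotone : ∀ {τ} → IsΦ σ τ → Monotone (DescentTop σ) (DescentBottom σ) τ
  IsΦ⇒Monotone {τ} isΦ = record
    { image  = image-top
    ; image⁻ = λ b → decidable-stable (DescentTop? σ _) λ ¬t → image-nontop ¬t b
    ; mono   = λ s t lt → let a , _ , p , eq = column s; a′ , _ , p′ , eq′ = column t in
        subst₂ Fin._<_ (sym eq) (sym eq′)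
          (zip-mono (descentBottoms σ) f′ (filter-sorted (DescentBottom? σ)) f′-sorted p p′ lt)
    ; mono-∁ = λ s t lt → let a , _ , p , eq = column-∁ s; a′ , _ , p′ , eq′ = column-∁ t in
        subst₂ Fin._<_ (sym eq) (sym eq′)
          (zip-mono (nondescentBottoms σ) g′ (filter-sorted (∁? (DescentBottom? σ))) g′-sorted p p′ lt)
    }
    where
    open IsΦ isΦ
    f′-sorted : AllPairs Fin._≤_ f′
    f′-sorted = prefixes⇒AllPairs f′ λ u x v eq →
      All.map ℕ.≮⇒≥ (filter-empty (x Fin.<?_) u (trans (f′-code u x v eq) (c≡0 x)))
    g′-sorted : AllPairs Fin._≤_ g′
    g′-sorted = suffixes⇒AllPairs g′ λ u x v eq →
      All.map ℕ.≮⇒≥ (filter-empty (Fin._<? x) v (trans (g′-code u x v eq) (c≡0 x)))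

    -- Equal lengths keep the two halves of the array apart: f stands over f′ and g over g′.
    length-f : length (descentBottoms σ) ≡ length f′
    length-f = trans (trans (sym (below-all (DescentBottom? σ))) (trans (below-bottoms σ) (below-all (DescentTop? σ))))
                     (sym (↭-length f′-arr))
    length-g : length (nondescentBottoms σ) ≡ length g′
    length-g = trans (trans (sym (below-all (∁? (DescentBottom? σ)))) (trans
        (below-∁-cong (DescentBottom? σ) (DescentTop? σ) n (below-bottoms σ))
        (below-all (∁? (DescentTop? σ)))))
      (sym (↭-length g′-arr))

    column : ∀ {b} → DescentTop σ b → ∃[ a ] a ∈ descentBottoms σ × (a , b) ∈ zip (descentBottoms σ) f′ × τ ⟨$⟩ʳ b ≡ a
    column {b} t = let a , a∈ , p = pair in a , a∈ , p , columns (∈-zip-++ˡ (descentBottoms σ) f′ p)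
      where
      pair = ∈-zip (descentBottoms σ) f′ (ℕ.≤-reflexive (sym length-f))
               (∈-resp-↭ (↭-sym f′-arr) (∈-filter⁺ (DescentTop? σ) (∈-allFin b) t))

    column-∁ : ∀ {b} → ¬ DescentTop σ b →
               ∃[ a ] a ∈ nondescentBottoms σ × (a , b) ∈ zip (nondescentBottoms σ) g′ × τ ⟨$⟩ʳ b ≡ a
    column-∁ {b} ¬t = let a , a∈ , p = pair in a , a∈ , p , columns (∈-zip-++ʳ (descentBottoms σ) f′ length-f p)
      where
      pair = ∈-zip (nondescentBottoms σ) g′ (ℕ.≤-reflexive (sym length-g))
               (∈-resp-↭ (↭-sym g′-arr) (∈-filter⁺ (∁? (DescentTop? σ)) (∈-allFin b) ¬t))

    image-top : ∀ {b} → DescentTop σ b → DescentBottom σ (τ ⟨$⟩ʳ b)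
    image-top t = let a , a∈ , _ , eq = column t in
      subst (DescentBottom σ) (sym eq) (proj₂ (∈-filter⁻ (DescentBottom? σ) {xs = allFin n} a∈))
    image-nontop : ∀ {b} → ¬ DescentTop σ b → ¬ DescentBottom σ (τ ⟨$⟩ʳ b)
    image-nontop ¬t = let a , a∈ , _ , eq = column-∁ ¬t in
      subst (∁ (DescentBottom σ)) (sym eq) (proj₂ (∈-filter⁻ (∁? (DescentBottom? σ)) {xs = allFin n} a∈))

  Φ-monotone : Monotone (DescentTop σ) (DescentBottom σ) (Φ σ)
  Φ-monotone = IsΦ⇒Monotone (Φ-correct σ)

-- Statistics

sum-allFin : (f : Fin n → ℕ) → ListAction.sum (map f (allFin n)) ≡ sum f
sum-allFin f = sum-map-tabulate f id

sum-#-swap : {R : Fin n → Fin n → Set} (R? : ∀ i j → Dec (R i j)) →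
  sum (λ i → # (R? i)) ≡ sum (λ j → # (λ i → R? i j))
sum-#-swap R? = begin
  sum (λ i → # (R? i))                          ≡⟨ sum-cong-≗ (λ i → #-sum (R? i)) ⟩
  sum (λ i → sum (λ j → indicator (R? i j)))    ≡⟨ ∑-comm (λ i j → indicator (R? i j)) ⟩
  sum (λ j → sum (λ i → indicator (R? i j)))    ≡⟨ sum-cong-≗ (λ j → #-sum (λ i → R? i j)) ⟨
  sum (λ j → # (λ i → R? i j))                  ∎
  where open ≡-Reasoning

-- The arrows b → τ b cross every level upwards as often as downwards.
up≡down : (τ : Permutation′ n) (k : ℕ) →
  # (λ b → (toℕ b ≤? k) ×-dec (k <? toℕ (τ ⟨$⟩ʳ b))) ≡ # (λ b → (toℕ (τ ⟨$⟩ʳ b) ≤? k) ×-dec (k <? toℕ b))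
up≡down {n} τ k = ℕ.+-cancelˡ-≡ (# both?) _ _ (trans
  (sym (#-⊎ both? _ (λ b → toℕ b ≤? k)
    (λ b p → split (toℕ (τ ⟨$⟩ʳ b) ≤? k) (p ,_) λ ≰ → p , ℕ.≰⇒> ≰)
    (λ _ → proj₁) (λ _ → proj₁) λ _ (_ , q) (_ , q′) → ℕ.<⇒≱ q′ q))
  (trans (#-reindex τ (λ b → toℕ b ≤? k))
  (#-⊎ both? _ (λ b → toℕ (τ ⟨$⟩ʳ b) ≤? k)
    (λ b p → split (toℕ b ≤? k) (_, p) λ ≰ → p , ℕ.≰⇒> ≰)
    (λ _ → proj₂) (λ _ → proj₁) λ _ (q , _) (_ , q′) → ℕ.<⇒≱ q′ q)))
  where
  both? : Decidable (λ (b : Fin n) → toℕ b ≤ k × toℕ (τ ⟨$⟩ʳ b) ≤ k)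
  both? b = (toℕ b ≤? k) ×-dec (toℕ (τ ⟨$⟩ʳ b) ≤? k)
  split : {A X Y : Set} → Dec A → (A → X) → (¬ A → Y) → X ⊎ Y
  split (yes a) f g = inj₁ (f a)
  split (no ¬a) f g = inj₂ (g ¬a)

module _ (τ : Permutation′ n) where

  exc-flip : exc (flip τ) ≡ drop τ
  exc-flip = sym (trans (#-reindex (flip τ) _) (#-cong {n = n} _ _
    (λ i → subst (Fin._< τ ⟨$⟩ˡ i) (inverseʳ τ)) (λ i → subst (Fin._< τ ⟨$⟩ˡ i) (sym (inverseʳ τ)))))

  drop-flip : drop (flip τ) ≡ exc τ
  drop-flip = sym (trans (#-reindex (flip τ) _) (#-cong {n = n} _ _
    (λ i → subst (τ ⟨$⟩ˡ i Fin.<_) (inverseʳ τ)) (λ i → subst (τ ⟨$⟩ˡ i Fin.<_) (sym (inverseʳ τ)))))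

  fix-flip : fix (flip τ) ≡ fix τ
  fix-flip = #-cong {n = n} _ _
    (λ i eq → trans (cong (τ ⟨$⟩ʳ_) (sym eq)) (inverseʳ τ))
    (λ i eq → trans (cong (τ ⟨$⟩ˡ_) (sym eq)) (inverseˡ τ))

  cdd-flip : cdd (flip τ) ≡ cda τ
  cdd-flip = #-cong {n = n} _ _ (λ _ (p , q) → q , p) (λ _ (p , q) → q , p)

  cda-flip : cda (flip τ) ≡ cdd τ
  cda-flip = #-cong {n = n} _ _ (λ _ (p , q) → q , p) (λ _ (p , q) → q , p)

  cval-flip : cval (flip τ) ≡ cval τ
  cval-flip = #-cong {n = n} _ _ (λ _ (p , q) → q , p) (λ _ (p , q) → q , p)

  cpk-flip : cpk (flip τ) ≡ cpk τ
  cpk-flip = #-cong {n = n} _ _ (λ _ (p , q) → q , p) (λ _ (p , q) → q , p)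

module _ {T B : Pred (Fin n) 0ℓ} {T? : Decidable T} {B? : Decidable B} {lo hi}
         (arcs : Arcs T? B? lo hi) {τ} (m : Monotone T B τ) where
  open Arcs arcs

  nontop⇒exc : ∀ {x} → ¬ T x → τ ⟨$⟩ʳ x ≢ x → x Fin.< τ ⟨$⟩ʳ x
  nontop⇒exc ¬t ≢ = ℕ.≤∧≢⇒< (nontop⇒nondrop arcs m ¬t) (≢ ∘ sym ∘ Fin.toℕ-injective)

  nonbottom⇒≤ : ∀ {x} → ¬ B x → τ ⟨$⟩ˡ x Fin.≤ x
  nonbottom⇒≤ ¬b = ℕ.≮⇒≥ (¬b ∘ dropValue⇒bottom arcs m)

  nonbottom⇒excValue : ∀ {x} → ¬ B x → τ ⟨$⟩ʳ x ≢ x → τ ⟨$⟩ˡ x Fin.< x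
  nonbottom⇒excValue ¬b ≢ = ℕ.≤∧≢⇒< (nonbottom⇒≤ ¬b)
    λ eq → ≢ (trans (cong (τ ⟨$⟩ʳ_) (sym (Fin.toℕ-injective eq))) (inverseʳ τ))

  excValue⇒nonbottom : ∀ {x} → τ ⟨$⟩ˡ x Fin.≤ x → ¬ B x
  excValue⇒nonbottom le b = ℕ.<⇒≱ (bottom⇒dropValue arcs m b) le

  private
    π : Permutation′ n
    π = flip τ

    crosses? : ∀ i j → Dec _
    crosses? i j =
      ((j Fin.<? i) ×-dec (i Fin.<? π ⟨$⟩ʳ j) ×-dec (π ⟨$⟩ʳ j Fin.<? π ⟨$⟩ʳ i))
      ⊎-dec
      ((π ⟨$⟩ʳ i Fin.<? π ⟨$⟩ʳ j) ×-dec (π ⟨$⟩ʳ j Fin.≤? i) ×-dec (i Fin.<? j))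

    inverse-cmp : ∀ {x y} → B x → B y → x Fin.< y → π ⟨$⟩ʳ x Fin.< π ⟨$⟩ʳ y
    inverse-cmp {x} {y} b c lt = Monotone-cmp T? m
      (image⁻ m (subst B (sym (inverseʳ τ)) b)) (image⁻ m (subst B (sym (inverseʳ τ)) c))
      (subst₂ Fin._<_ (sym (inverseʳ τ)) (sym (inverseʳ τ)) lt)

    inverse-cmp-∁ : ∀ {x y} → ¬ B x → ¬ B y → x Fin.< y → π ⟨$⟩ʳ x Fin.< π ⟨$⟩ʳ y
    inverse-cmp-∁ {x} {y} b c lt = Monotone-cmp (∁? T?) (Monotone-∁ T? m)
      (b ∘ subst B (inverseʳ τ) ∘ image m) (c ∘ subst B (inverseʳ τ) ∘ image m)
      (subst₂ Fin._<_ (sym (inverseʳ τ)) (sym (inverseʳ τ)) lt)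

    straddle-drop : ∀ (x : Fin n) → straddle (toℕ x) ≡ # (λ (b : Fin n) → (τ ⟨$⟩ʳ b Fin.<? x) ×-dec (x Fin.<? b))
    straddle-drop x = trans (cross-drops arcs m (ℕ.n≤1+n _) ℕ.≤-refl)
      (#-cong {n = n} _ _ (λ _ (p , q) → p , s≤s⁻¹ q) (λ _ (p , q) → p , s≤s q))

    crosses-bottom : ∀ x → B x → # (crosses? x) ≡ straddle (toℕ x)
    crosses-bottom x b = trans
      (#-cong {n = n} (crosses? x) (λ j → (j Fin.<? x) ×-dec (x Fin.<? π ⟨$⟩ʳ j))
        (λ { j (inj₁ (j<x , x<πj , _)) → j<x , x<πj
           ; j (inj₂ (πx<πj , πj≤x , _)) →
               contradiction (bottom⇒dropValue arcs m b) (ℕ.<⇒≯ (ℕ.<-≤-trans πx<πj πj≤x)) })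
        (λ j (j<x , x<πj) → inj₁ (j<x , x<πj ,
          inverse-cmp (dropValue⇒bottom arcs m (ℕ.<-trans j<x x<πj)) b j<x)))
      (trans (#-reindex τ _) (trans
        (#-cong {n = n} _ _ (λ _ (p , q) → p , subst (x Fin.<_) (inverseˡ τ) q)
                            (λ _ (p , q) → p , subst (x Fin.<_) (sym (inverseˡ τ)) q))
        (sym (straddle-drop x))))

    crosses-nonbottom : ∀ x → ¬ B x → # (crosses? x) ≡ straddle (toℕ x)
    crosses-nonbottom x ¬b = trans
      (#-cong {n = n} (crosses? x) (λ j → (π ⟨$⟩ʳ j Fin.≤? x) ×-dec (x Fin.<? j))
        (λ { j (inj₁ (_ , x<πj , πj<πx)) →
               contradiction (nonbottom⇒≤ ¬b) (ℕ.<⇒≱ (ℕ.<-trans x<πj πj<πx))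
           ; j (inj₂ (_ , πj≤x , x<j)) → πj≤x , x<j })
        (λ j (πj≤x , x<j) → inj₂
          (inverse-cmp-∁ ¬b (excValue⇒nonbottom (ℕ.≤-trans πj≤x (ℕ.<⇒≤ x<j))) x<j , πj≤x , x<j)))
      -- Exchanges π j ≤ x < j for j ≤ x < π j. Then j = x is impossible because π x ≤ x, which
      -- makes the first inequality strict.
      (trans (sym (up≡down π (toℕ x))) (trans (#-reindex τ _) (trans
        (#-cong {n = n} _ _
          (λ b (p , q) → ℕ.≤∧≢⇒< p (λ eq → ℕ.<⇒≱ (subst (x Fin.<_) (inverseˡ τ) q)
               (subst (λ y → y Fin.≤ x) (trans (cong (π ⟨$⟩ʳ_) (sym (Fin.toℕ-injective eq))) (inverseˡ τ))
                  (nonbottom⇒≤ ¬b)))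
             , subst (x Fin.<_) (inverseˡ τ) q)
          (λ b (p , q) → ℕ.<⇒≤ p , subst (x Fin.<_) (sym (inverseˡ τ)) q))
        (sym (straddle-drop x)))))

  -- For x in B only the first alternative of `cros` can occur, for the other x only the second. In
  -- either case the comparison of the images of x and j under τ⁻¹ is automatic by monotonicity, and
  -- what remains counts arrows across x.
  icr-straddle : icr τ ≡ sum (λ (x : Fin n) → straddle (toℕ x))
  icr-straddle = trans (sum-allFin (λ x → # (crosses? x))) (sum-cong-≗ pointwise)
    where
    pointwise : ∀ x → # (crosses? x) ≡ straddle (toℕ x)
    pointwise x with B? x
    ... | yes b = crosses-bottom x b
    ... | no ¬b = crosses-nonbottom x ¬b

module _ {σ : Permutation′ n} (avoids : Avoids231 σ)
         {τ} (m : Monotone (DescentTop σ) (DescentBottom σ) τ) where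
  private
    arcs = descentArcs σ
  open Arcs arcs

  private
    letter-≤∧≢ : ∀ {i j} → letter σ i ≤ letter σ j → i ≢ j → letter σ i < letter σ j
    letter-≤∧≢ le i≢j = ℕ.≤∧≢⇒< le (i≢j ∘ letter-injective σ)

    after<⇒drop : ∀ i → after σ i < letter σ i → τ ⟨$⟩ʳ (σ ⟨$⟩ʳ i) Fin.< σ ⟨$⟩ʳ i
    after<⇒drop i = top⇒drop arcs m ∘ descentTop⁺ σ

    drop⇒after< : ∀ i → τ ⟨$⟩ʳ (σ ⟨$⟩ʳ i) Fin.< σ ⟨$⟩ʳ i → after σ i < letter σ i
    drop⇒after< i = descentTop⁻ σ ∘ drop⇒top arcs m

    <after⇒nontop : ∀ i → letter σ i < after σ i → ¬ DescentTop σ (σ ⟨$⟩ʳ i)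
    <after⇒nontop i lt t = ℕ.<⇒≯ lt (descentTop⁻ σ t)

    nontop⇒<after : ∀ i → ¬ DescentTop σ (σ ⟨$⟩ʳ i) → letter σ i < after σ i
    nontop⇒<after i ¬t = ℕ.≤∧≢⇒< (ℕ.≮⇒≥ (¬t ∘ descentTop⁺ σ)) (after≢letter σ i ∘ sym)

    <before⇒dropValue : ∀ i → letter σ i < before σ i → σ ⟨$⟩ʳ i Fin.< τ ⟨$⟩ˡ (σ ⟨$⟩ʳ i)
    <before⇒dropValue i = bottom⇒dropValue arcs m ∘ descentBottom⁺ σ

    dropValue⇒<before : ∀ i → σ ⟨$⟩ʳ i Fin.< τ ⟨$⟩ˡ (σ ⟨$⟩ʳ i) → letter σ i < before σ i
    dropValue⇒<before i = descentBottom⁻ σ ∘ dropValue⇒bottom arcs m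

    before<⇒nonbottom : ∀ i → before σ i < letter σ i → ¬ DescentBottom σ (σ ⟨$⟩ʳ i)
    before<⇒nonbottom i lt b = ℕ.<⇒≯ lt (descentBottom⁻ σ b)

    nonbottom⇒before< : ∀ i → ¬ DescentBottom σ (σ ⟨$⟩ʳ i) → before σ i < letter σ i
    nonbottom⇒before< i ¬b = ℕ.≤∧≢⇒< (ℕ.≮⇒≥ (¬b ∘ descentBottom⁺ σ)) (before≢letter σ i)

    exc⇒nontop : ∀ {x} → x Fin.< τ ⟨$⟩ʳ x → ¬ DescentTop σ x
    exc⇒nontop lt t = ℕ.<⇒≯ lt (top⇒drop arcs m t)

  des≡drop : des σ ≡ drop τ
  des≡drop = trans (#-cong {n = n} _ _ after<⇒drop drop⇒after<) (sym (#-reindex σ _))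

  asc∞≡exc+fix : asc∞ σ ≡ exc τ + fix τ
  asc∞≡exc+fix = trans
    (trans (#-cong {n = n} _ (λ i → ∁? (DescentTop? σ) (σ ⟨$⟩ʳ i)) <after⇒nontop nontop⇒<after)
           (sym (#-reindex σ (∁? (DescentTop? σ)))))
    (#-⊎ {n = n} _ _ _ split (λ _ → exc⇒nontop) (λ _ eq → proj₁ (fixed⇒ arcs m eq))
      (λ _ lt eq → ℕ.<-irrefl (cong toℕ (sym eq)) lt))
    where
    split : ∀ x → ¬ DescentTop σ x → x Fin.< τ ⟨$⟩ʳ x ⊎ τ ⟨$⟩ʳ x ≡ x
    split x ¬t with τ ⟨$⟩ʳ x Fin.≟ x
    ... | yes eq = inj₂ eq
    ... | no  ≢  = inj₁ (nontop⇒exc arcs m ¬t ≢)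

  lpk≡cpk : lpk σ ≡ cpk τ
  lpk≡cpk = trans (#-cong {n = n} _ _
      (λ i (p , q) → let d = after<⇒drop i q in
         nonbottom⇒excValue arcs m (before<⇒nonbottom i p) (ℕ.<⇒≢ d ∘ cong toℕ) , d)
      (λ i (p , q) → nonbottom⇒before< i (excValue⇒nonbottom arcs m (ℕ.<⇒≤ p)) , drop⇒after< i q))
    (sym (#-reindex σ _))

  lval≡cval : lval σ ≡ cval τ
  lval≡cval = trans (#-cong {n = n} _ _
      (λ i (p , q) → let b = descentBottom⁺ σ p in
         bottom⇒dropValue arcs m b ,
         nontop⇒exc arcs m (<after⇒nontop i q) (λ eq → proj₁ (proj₂ (fixed⇒ arcs m eq)) b))
      (λ i (p , q) → dropValue⇒<before i p , nontop⇒<after i (exc⇒nontop q)))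
    (sym (#-reindex σ _))

  ldd≡cdd : ldd σ ≡ cdd τ
  ldd≡cdd = trans (#-cong {n = n} _ _
      (λ i (p , q) → <before⇒dropValue i p , after<⇒drop i q)
      (λ i (p , q) → dropValue⇒<before i p , drop⇒after< i q))
    (sym (#-reindex σ _))

  -- Double ascents are the letters that are neither tops nor bottoms, and these are fixed by τ or
  -- else enter from below and leave upwards. With `fmax≡fix` this leaves `cda` for the difference.
  lda≡fix+cda : lda σ ≡ fix τ + cda τ
  lda≡fix+cda = trans (#-⊎ {n = n} _ _ _ split
      (λ i eq → let ¬t , ¬b , _ = fixed⇒ arcs m eq in nonbottom⇒before< i ¬b , nontop⇒<after i ¬t)
      (λ i (p , q) → nonbottom⇒before< i (excValue⇒nonbottom arcs m (ℕ.<⇒≤ p)) , nontop⇒<after i (exc⇒nontop q))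
      (λ i eq (_ , q) → ℕ.<-irrefl (cong toℕ (sym eq)) q))
    (sym (cong₂ _+_ (#-reindex σ _) (#-reindex σ _)))
    where
    split : ∀ i → before σ i < letter σ i × letter σ i < after σ i → let x = σ ⟨$⟩ʳ i in
            τ ⟨$⟩ʳ x ≡ x ⊎ (τ ⟨$⟩ˡ x Fin.< x × x Fin.< τ ⟨$⟩ʳ x)
    split i (p , q) with τ ⟨$⟩ʳ (σ ⟨$⟩ʳ i) Fin.≟ σ ⟨$⟩ʳ i
    ... | yes eq = inj₁ eq
    ... | no  ≢  = inj₂ (nonbottom⇒excValue arcs m (before<⇒nonbottom i p) ≢ ,
                         nontop⇒exc arcs m (<after⇒nontop i q) ≢)

  -- A double ascent is fixed by τ iff no descent passes over it; a larger letter on its left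
  -- would force such a descent, and on its right there is none by 231-avoidance.
  fmax≡fix : fmax σ ≡ fix τ
  fmax≡fix = trans (#-cong {n = n} _ _ fmax⇒fixed fixed⇒fmax) (sym (#-reindex σ _))
    where
    fmax⇒fixed : ∀ i → (before σ i < letter σ i × letter σ i < after σ i) ×
                 (∀ j → j Fin.< i → letter σ j < letter σ i) → τ ⟨$⟩ʳ (σ ⟨$⟩ʳ i) ≡ σ ⟨$⟩ʳ i
    fmax⇒fixed i ((p , q) , max) = fixed⇐ arcs m (<after⇒nontop i q) (before<⇒nonbottom i p)
      (#-empty {n = n} _ ¬over)
      where
      ¬over : ∀ k → ¬ (after σ k ≤ toℕ (σ ⟨$⟩ʳ i) × toℕ (σ ⟨$⟩ʳ i) < letter σ k)
      ¬over k (lo , hi) with Fin.<-cmp k i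
      ... | tri< k<i _ _  = ℕ.<⇒≱ (max k k<i) hi
      ... | tri≈ _ refl _ = ℕ.<⇒≯ q (s≤s lo)
      ... | tri> _ k≢i i<k = no231 avoids i<k (s≤s lo) (letter-≤∧≢ hi (k≢i ∘ sym))

    fixed⇒fmax : ∀ i → τ ⟨$⟩ʳ (σ ⟨$⟩ʳ i) ≡ σ ⟨$⟩ʳ i →
                 (before σ i < letter σ i × letter σ i < after σ i) ×
                 (∀ j → j Fin.< i → letter σ j < letter σ i)
    fixed⇒fmax i eq = let ¬t , ¬b , over≡0 = fixed⇒ arcs m eq in
      (nonbottom⇒before< i ¬b , nontop⇒<after i ¬t) ,
      λ j j<i → letter-≤∧≢ (ℕ.≮⇒≥ (¬larger ¬b over≡0 j<i)) (ℕ.<⇒≢ j<i ∘ cong toℕ)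
      where
      ¬larger : ¬ DescentBottom σ (σ ⟨$⟩ʳ i) → over (toℕ (σ ⟨$⟩ʳ i)) ≡ 0 →
                ∀ {j} → j Fin.< i → ¬ (letter σ i < letter σ j)
      ¬larger ¬b over≡0 j<i gt =
        let k , l , k⋖l , _ , _ , above , ¬above = crossing (λ k → letter σ i <? letter σ k) j<i gt (ℕ.<-irrefl refl)
        in ¬descent k⋖l above (ℕ.≮⇒≥ ¬above)
        where
        ¬descent : ∀ {k l} → k ⋖ l → letter σ i < letter σ k → ¬ (letter σ l ≤ letter σ i)
        ¬descent {k} {l} k⋖l above below with l Fin.≟ i
        ... | yes refl = ¬b (descentBottom⁺ σ (⋖⇒descentˡ σ k⋖l (s≤s⁻¹ above)))
        ... | no l≢i   = ℕ.<⇒≢ (#-positive {n = n} _ k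
          (s≤s⁻¹ (subst (_< letter σ i) (sym (after-⋖ σ k⋖l)) (letter-≤∧≢ below l≢i)) ,
           ℕ.<-trans ℕ.≤-refl above)) (sym over≡0)

  -- Occurrences are grouped by the letter playing 2. No descent straddling that letter lies to its
  -- right, so the position condition in `31-2` holds by itself and all straddling descents are
  -- counted.
  31-2≡icr : 31-2 σ ≡ icr τ
  31-2≡icr = begin
    31-2 σ                                        ≡⟨ sum-allFin (λ i → # (R? i)) ⟩
    sum (λ i → # (R? i))                          ≡⟨ sum-#-swap R? ⟩
    sum (λ j → # (λ i → R? i j))                  ≡⟨ sum-cong-≗ pointwise ⟩
    sum (λ j → straddle (toℕ (σ ⟨$⟩ʳ j)))         ≡⟨ sum-permute (straddle ∘ toℕ) σ ⟨
    sum (λ (x : Fin n) → straddle (toℕ x))        ≡⟨ icr-straddle arcs m ⟨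
    icr τ                                         ∎
    where
    open ≡-Reasoning
    R? : ∀ i j → Dec _
    R? i j = (suc (toℕ i) <? toℕ j) ×-dec (after σ i <? letter σ j) ×-dec (letter σ j <? letter σ i)
    pointwise : ∀ j → # (λ i → R? i j) ≡ straddle (toℕ (σ ⟨$⟩ʳ j))
    pointwise j = #-cong {n = n} (λ i → R? i j) _ (λ i (_ , lo , hi) → s≤s⁻¹ lo , hi) far
      where
      far : ∀ i → after σ i ≤ toℕ (σ ⟨$⟩ʳ j) × letter σ j < letter σ i → _
      far i (lo , hi) with Fin.<-cmp j i
      ... | tri< j<i _ _  = ⊥-elim (no231 avoids j<i (s≤s lo) hi)
      ... | tri≈ _ refl _ = ⊥-elim (ℕ.<-irrefl refl hi)
      -- If j came directly after i, its letter would be the bottom of the descent and not strictly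
      -- inside it.
      ... | tri> _ _ i<j  = ℕ.≤∧≢⇒< i<j (λ i⋖j → ℕ.<-irrefl (after-⋖ σ (sym i⋖j)) (s≤s lo)) , s≤s lo , hi

-- The order of the letters of a 231-avoiding permutation

-- Two of the three letters of a 321 lie both in T or both outside T, where τ is increasing.
Monotone⇒Avoids321 : {T B : Pred (Fin n) 0ℓ} (T? : Decidable T) {τ : Permutation′ n} →
                     Monotone T B τ → Avoids321 τ
Monotone⇒Avoids321 T? m (i , j , k , i<j , j<k , τk<τj , τj<τi) with T? i | T? j | T? k
... | yes s | yes t | _     = ℕ.<⇒≯ (mono m s t i<j) τj<τi
... | yes s | no  _ | yes t = ℕ.<⇒≯ (mono m s t (ℕ.<-trans i<j j<k)) (ℕ.<-trans τk<τj τj<τi)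
... | no  s | yes _ | no  t = ℕ.<⇒≯ (mono-∁ m s t (ℕ.<-trans i<j j<k)) (ℕ.<-trans τk<τj τj<τi)
... | no  s | no  t | _     = ℕ.<⇒≯ (mono-∁ m s t i<j) τj<τi
... | no  _ | yes s | yes t = ℕ.<⇒≯ (mono m s t j<k) τk<τj
... | yes _ | no  s | no  t = ℕ.<⇒≯ (mono-∁ m s t j<k) τk<τj

dropLevel : Permutation′ n → ℕ → ℕ
dropLevel τ k = cross (letter τ) (suc ∘ toℕ) k k

-- For x < y, the 231-avoiding preimage of τ under Φ has y to the left of x iff Covers τ y x.
Covers : Permutation′ n → Fin n → Fin n → Set
Covers τ y x = x Fin.< y × τ ⟨$⟩ʳ y Fin.< y ×
               (∀ z → toℕ x < z → z ≤ toℕ y → dropLevel τ (toℕ y) ≤ dropLevel τ z)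

Before : Permutation′ n → Fin n → Fin n → Set
Before τ y x = Covers τ y x ⊎ (y Fin.< x × ¬ Covers τ x y)

Before-asym : (τ : Permutation′ n) → ∀ {x y} → Before τ x y → ¬ Before τ y x
Before-asym τ (inj₁ (y<x , _)) (inj₁ (x<y , _))  = ℕ.<⇒≯ x<y y<x
Before-asym τ (inj₁ cov)       (inj₂ (_ , ¬cov)) = ¬cov cov
Before-asym τ (inj₂ (_ , ¬cov)) (inj₁ cov)       = ¬cov cov
Before-asym τ (inj₂ (x<y , _)) (inj₂ (y<x , _))  = ℕ.<⇒≯ x<y y<x

module _ {σ : Permutation′ n} (avoids : Avoids231 σ) where
  open Arcs (descentArcs σ)

  private
    ≤∧≢ : ∀ {i j} → σ ⟨$⟩ʳ i Fin.≤ σ ⟨$⟩ʳ j → i ≢ j → σ ⟨$⟩ʳ i Fin.< σ ⟨$⟩ʳ j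
    ≤∧≢ le i≢j = ℕ.≤∧≢⇒< le (i≢j ∘ ʳ-injective σ ∘ Fin.toℕ-injective)

  -- If σ rose directly after i, then i, i + 1 and j would form a 231.
  inversion⇒descent : ∀ {i j} → i Fin.< j → σ ⟨$⟩ʳ j Fin.< σ ⟨$⟩ʳ i → DescentTop σ (σ ⟨$⟩ʳ i)
  inversion⇒descent {i} {j} i<j inv = let k , i⋖k , k≤j = next i<j in go k i⋖k k≤j
    where
    go : ∀ k → i ⋖ k → k Fin.≤ j → DescentTop σ (σ ⟨$⟩ʳ i)
    go k i⋖k k≤j with Fin.<-cmp (σ ⟨$⟩ʳ k) (σ ⟨$⟩ʳ i)
    ... | tri< lt _ _ = descentTop⁺ σ (⋖⇒descent σ i⋖k lt)
    ... | tri≈ _ eq _ = contradiction (cong toℕ (sym (ʳ-injective σ eq))) (ℕ.<⇒≢ (⋖⇒< i⋖k))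
    ... | tri> _ _ gt = ⊥-elim (avoids (i , k , j , ⋖⇒< i⋖k , k<j , inv , gt))
      where
      k<j : k Fin.< j
      k<j = ℕ.≤∧≢⇒< k≤j λ eq →
        ℕ.<⇒≯ gt (subst (λ l → σ ⟨$⟩ʳ l Fin.< σ ⟨$⟩ʳ i) (sym (Fin.toℕ-injective eq)) inv)

  -- A descent over level σ(i) lies weakly left of i. The one at i itself is traded for a descent
  -- between i and j, the other ones pass over z already.
  inversion⇒over : ∀ {i j} → i Fin.< j → ∀ z → toℕ (σ ⟨$⟩ʳ j) < z → z ≤ toℕ (σ ⟨$⟩ʳ i) →
                   over (toℕ (σ ⟨$⟩ʳ i)) ≤ over z
  inversion⇒over {i} {j} i<j z σj<z z≤σi =
    let k₀ , l₀ , k₀⋖l₀ , i≤k₀ , _ , z≤k₀ , z≰l₀ =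
          crossing (λ k → z ≤? toℕ (σ ⟨$⟩ʳ k)) i<j z≤σi (ℕ.<⇒≱ σj<z)
    in trade k₀ i≤k₀ (subst (_≤ z) (sym (after-⋖ σ k₀⋖l₀)) (ℕ.≰⇒> z≰l₀)) (s≤s z≤k₀)
    where
    trade : ∀ k₀ → i Fin.≤ k₀ → after σ k₀ ≤ z → z < letter σ k₀ → over (toℕ (σ ⟨$⟩ʳ i)) ≤ over z
    trade k₀ i≤k₀ lo₀ hi₀ = #-injection {n = n} _ _ R image-R R-injective
      where
      R : Fin n → Fin n → Set
      R k k′ = (k ≡ i × k′ ≡ k₀) ⊎ (k Fin.< i × k′ ≡ k)

      R-injective : ∀ k l k′ → R k k′ → R l k′ → k ≡ l
      R-injective _ _ _ (inj₁ (p , _))   (inj₁ (q , _))   = trans p (sym q)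
      R-injective _ _ _ (inj₁ (_ , refl)) (inj₂ (lt , refl)) = contradiction i≤k₀ (ℕ.<⇒≱ lt)
      R-injective _ _ _ (inj₂ (lt , refl)) (inj₁ (_ , refl)) = contradiction i≤k₀ (ℕ.<⇒≱ lt)
      R-injective _ _ _ (inj₂ (_ , p))   (inj₂ (_ , q))   = trans (sym p) q

      -- A descent bottom l of height at least z would form a 231 with i and j.
      after≤z : ∀ {k} → k Fin.< i → after σ k ≤ toℕ (σ ⟨$⟩ʳ i) → after σ k ≤ z
      after≤z {k} k<i lo = let l , k⋖l , l≤i = next k<i in go l k⋖l l≤i
        where
        go : ∀ l → k ⋖ l → l Fin.≤ i → after σ k ≤ z
        go l k⋖l l≤i = subst (_≤ z) (sym (after-⋖ σ k⋖l)) (ℕ.≰⇒> λ z≤σl →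
          avoids (l , i , j , l<i , i<j , ℕ.<-≤-trans σj<z z≤σl , σl<σi))
          where
          σl<σi : σ ⟨$⟩ʳ l Fin.< σ ⟨$⟩ʳ i
          σl<σi = subst (_≤ toℕ (σ ⟨$⟩ʳ i)) (after-⋖ σ k⋖l) lo
          l<i : l Fin.< i
          l<i = ℕ.≤∧≢⇒< l≤i λ eq → ℕ.<⇒≢ σl<σi (cong (toℕ ∘ (σ ⟨$⟩ʳ_)) (Fin.toℕ-injective eq))

      image-R : ∀ k → after σ k ≤ toℕ (σ ⟨$⟩ʳ i) × toℕ (σ ⟨$⟩ʳ i) < letter σ k →
                ∃[ k′ ] (after σ k′ ≤ z × z < letter σ k′) × R k k′
      image-R k (lo , hi) with Fin.<-cmp k i
      ... | tri< k<i _ _  = k , (after≤z k<i lo , ℕ.≤-<-trans z≤σi hi) , inj₂ (k<i , refl)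
      ... | tri≈ _ k≡i _  = k₀ , (lo₀ , hi₀) , inj₁ (k≡i , refl)
      ... | tri> _ k≢i i<k = ⊥-elim (no231 avoids i<k (s≤s lo) (s≤s (≤∧≢ (s≤s⁻¹ hi) (k≢i ∘ sym))))

  -- Here w and v = w + 1 are letters to the left and to the right of j. A descent over v lies to
  -- the left of j and passes over σ(j) too, but the descent at j passes only over σ(j).
  noninversion⇒over : ∀ {i j} → i Fin.< j → σ ⟨$⟩ʳ i Fin.< σ ⟨$⟩ʳ j → DescentTop σ (σ ⟨$⟩ʳ j) →
    ∃[ v ] σ ⟨$⟩ʳ i Fin.< v × v Fin.≤ σ ⟨$⟩ʳ j × over (toℕ v) < over (toℕ (σ ⟨$⟩ʳ j))
  noninversion⇒over {i} {j} i<j σi<σj top =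
    let k , j⋖k , σk<σj = descent⇒⋖ σ (descentTop⁻ σ top)
        w , v , w⋖v , σi≤w , v≤σk , w-left , ¬v-left =
          crossing (λ x → σ ⟨$⟩ˡ x Fin.<? j) (σi<σk k j⋖k σk<σj)
            (subst (Fin._< j) (sym (inverseˡ σ)) i<j)
            (λ lt → ℕ.<⇒≯ (⋖⇒< j⋖k) (subst (Fin._< j) (inverseˡ σ) lt))
        v<σj = ℕ.≤-<-trans v≤σk σk<σj
    in v , ℕ.≤-<-trans σi≤w (⋖⇒< w⋖v) , ℕ.<⇒≤ v<σj ,
       fewer k j⋖k w v w⋖v v≤σk v<σj w-left (right v v<σj ¬v-left)
    where
    -- Otherwise i, j and k would form a 231. Hence going up from σ(i), left of j, to σ(k), right of
    -- j, the side changes somewhere.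
    σi<σk : ∀ k → j ⋖ k → σ ⟨$⟩ʳ k Fin.< σ ⟨$⟩ʳ j → σ ⟨$⟩ʳ i Fin.< σ ⟨$⟩ʳ k
    σi<σk k j⋖k σk<σj = ≤∧≢
      (ℕ.≮⇒≥ λ σk<σi → avoids (i , j , k , i<j , ⋖⇒< j⋖k , σk<σi , σi<σj))
      λ i≡k → ℕ.<⇒≢ (ℕ.<-trans i<j (⋖⇒< j⋖k)) (cong toℕ i≡k)

    right : ∀ v → v Fin.< σ ⟨$⟩ʳ j → ¬ (σ ⟨$⟩ˡ v Fin.< j) → j Fin.< σ ⟨$⟩ˡ v
    right v v<σj ¬left = ℕ.≤∧≢⇒< (ℕ.≮⇒≥ ¬left)
      λ eq → ℕ.<⇒≢ v<σj (cong toℕ (trans (sym (inverseʳ σ)) (cong (σ ⟨$⟩ʳ_) (Fin.toℕ-injective (sym eq)))))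

    fewer : ∀ k → j ⋖ k → ∀ w v → w ⋖ v → v Fin.≤ σ ⟨$⟩ʳ k → v Fin.< σ ⟨$⟩ʳ j →
            σ ⟨$⟩ˡ w Fin.< j → j Fin.< σ ⟨$⟩ˡ v → over (toℕ v) < over (toℕ (σ ⟨$⟩ʳ j))
    fewer k j⋖k w v w⋖v v≤σk v<σj w-left v-right = #-strict {n = n} _ _
      (λ q (lo , hi) → ℕ.≤-trans lo (ℕ.<⇒≤ v<σj) , s≤s (above q lo (s≤s⁻¹ hi)))
      j
      (ℕ.<⇒≤pred (descentTop⁻ σ top) , ℕ.≤-refl)
      (λ (lo , _) → ℕ.<⇒≱ (subst (_≤ toℕ v) (after-⋖ σ j⋖k) lo) v≤σk)
      where
      -- A letter smaller than w standing to the right of j would complete w and σ(j) to a 231.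
      left : ∀ l → σ ⟨$⟩ʳ l Fin.< v → l Fin.< j
      left l σl<v with Fin.<-cmp l j
      ... | tri< l<j _ _  = l<j
      ... | tri≈ _ refl _ = contradiction σl<v (ℕ.<⇒≯ v<σj)
      ... | tri> _ _ j<l with ℕ.m≤n⇒m<n∨m≡n (⋖-below {i = w} {j = v} {k = σ ⟨$⟩ʳ l} w⋖v σl<v)
      ...   | inj₁ σl<w = ⊥-elim (avoids (σ ⟨$⟩ˡ w , j , l , w-left , j<l ,
                subst (σ ⟨$⟩ʳ l Fin.<_) (sym (inverseʳ σ)) σl<w ,
                subst (Fin._< σ ⟨$⟩ʳ j) (sym (inverseʳ σ)) (ℕ.<-trans (⋖⇒< w⋖v) v<σj)))
      ...   | inj₂ σl≡w = subst (Fin._< j)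
                (trans (cong (σ ⟨$⟩ˡ_) (sym (Fin.toℕ-injective σl≡w))) (inverseˡ σ)) w-left

      -- The bottom of the descent is below v, hence left of j, and so is its top. If the top were
      -- below σ(j), then the top, σ(j) and v would form a 231.
      above : ∀ q → after σ q ≤ toℕ v → v Fin.≤ σ ⟨$⟩ʳ q → σ ⟨$⟩ʳ j Fin.≤ σ ⟨$⟩ʳ q
      above q lo v≤σq = let l , q⋖l , after≡ = after≤⇒⋖ σ {q} (ℕ.≤-trans lo (ℕ.<⇒≤ (Fin.toℕ<n v)))
                            q<j = ℕ.<-trans (⋖⇒< q⋖l) (left l (subst (_≤ toℕ v) after≡ lo))
                        in ℕ.≮⇒≥ λ σq<σj → avoids (q , j , σ ⟨$⟩ˡ v , q<j , v-right ,
                             subst (Fin._< σ ⟨$⟩ʳ q) (sym (inverseʳ σ)) (v<σq q<j) , σq<σj)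
        where
        v<σq : q Fin.< j → v Fin.< σ ⟨$⟩ʳ q
        v<σq q<j = ℕ.≤∧≢⇒< v≤σq λ eq → ℕ.<⇒≢ (ℕ.<-trans q<j v-right)
          (cong toℕ (trans (sym (inverseˡ σ)) (cong (σ ⟨$⟩ˡ_) (sym (Fin.toℕ-injective eq)))))

  module _ {τ} (m : Monotone (DescentTop σ) (DescentBottom σ) τ) where

    private
      over≡dropLevel : ∀ k → over k ≡ dropLevel τ k
      over≡dropLevel k = cross-drops (descentArcs σ) m ℕ.≤-refl (ℕ.n≤1+n k)

    inversion⇒Covers : ∀ {i j} → i Fin.< j → σ ⟨$⟩ʳ j Fin.< σ ⟨$⟩ʳ i → Covers τ (σ ⟨$⟩ʳ i) (σ ⟨$⟩ʳ j)
    inversion⇒Covers i<j inv = inv , top⇒drop (descentArcs σ) m (inversion⇒descent i<j inv) ,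
      λ z lo hi → subst₂ _≤_ (over≡dropLevel _) (over≡dropLevel z) (inversion⇒over i<j z lo hi)

    noninversion⇒¬Covers : ∀ {i j} → i Fin.< j → σ ⟨$⟩ʳ i Fin.< σ ⟨$⟩ʳ j → ¬ Covers τ (σ ⟨$⟩ʳ j) (σ ⟨$⟩ʳ i)
    noninversion⇒¬Covers i<j lt (_ , drop , levels) =
      let v , σi<v , v≤σj , less = noninversion⇒over i<j lt (drop⇒top (descentArcs σ) m drop)
      in ℕ.<⇒≱ less (subst₂ _≤_ (sym (over≡dropLevel _)) (sym (over≡dropLevel _)) (levels (toℕ v) σi<v v≤σj))

    -- `Before` mentions τ only and is asymmetric, so this pins down the order of the letters of σ.
    <⇒Before : ∀ {i j} → i Fin.< j → Before τ (σ ⟨$⟩ʳ i) (σ ⟨$⟩ʳ j)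
    <⇒Before {i} {j} i<j with Fin.<-cmp (σ ⟨$⟩ʳ i) (σ ⟨$⟩ʳ j)
    ... | tri< lt _ _ = inj₂ (lt , noninversion⇒¬Covers i<j lt)
    ... | tri≈ _ eq _ = contradiction (cong toℕ (ʳ-injective σ eq)) (ℕ.<⇒≢ i<j)
    ... | tri> _ _ gt = inj₁ (inversion⇒Covers i<j gt)

-- Recovering a word from the order of its letters

module _ {σ σ′ : Permutation′ n} where

  order-preserving⇒≈ : (∀ {x y} → σ ⟨$⟩ˡ x Fin.< σ ⟨$⟩ˡ y → σ′ ⟨$⟩ˡ x Fin.< σ′ ⟨$⟩ˡ y) →
                       (∀ {x y} → σ′ ⟨$⟩ˡ x Fin.< σ′ ⟨$⟩ˡ y → σ ⟨$⟩ˡ x Fin.< σ ⟨$⟩ˡ y) → σ ≈ σ′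
  order-preserving⇒≈ f g i = begin
    σ ⟨$⟩ʳ i                              ≡⟨ inverseʳ σ′ ⟨
    σ′ ⟨$⟩ʳ (σ′ ⟨$⟩ˡ (σ ⟨$⟩ʳ i))          ≡⟨ cong (σ′ ⟨$⟩ʳ_) (positions (σ ⟨$⟩ʳ i)) ⟨
    σ′ ⟨$⟩ʳ (σ ⟨$⟩ˡ (σ ⟨$⟩ʳ i))           ≡⟨ cong (σ′ ⟨$⟩ʳ_) (inverseˡ σ) ⟩
    σ′ ⟨$⟩ʳ i                             ∎
    where
    open ≡-Reasoning
    -- The position of a letter is the number of letters to its left, which the order alone
    -- determines.
    count : (ρ : Permutation′ n) → ∀ x → # (λ y → ρ ⟨$⟩ˡ y Fin.<? ρ ⟨$⟩ˡ x) ≡ toℕ (ρ ⟨$⟩ˡ x)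
    count ρ x = trans (sym (#-reindex (flip ρ) (λ (j : Fin n) → j Fin.<? ρ ⟨$⟩ˡ x))) (#-initial _)
    positions : ∀ x → σ ⟨$⟩ˡ x ≡ σ′ ⟨$⟩ˡ x
    positions x = Fin.toℕ-injective (trans (sym (count σ x))
      (trans (#-cong {n = n} _ _ (λ _ → f) (λ _ → g)) (count σ′ x)))

module _ {σ σ′ : Permutation′ n} (avoids : Avoids231 σ) (avoids′ : Avoids231 σ′) {τ}
         (m : Monotone (DescentTop σ) (DescentBottom σ) τ)
         (m′ : Monotone (DescentTop σ′) (DescentBottom σ′) τ) where

  private
    transfer : {ρ ρ′ : Permutation′ n} → Avoids231 ρ → Avoids231 ρ′ →
      Monotone (DescentTop ρ) (DescentBottom ρ) τ → Monotone (DescentTop ρ′) (DescentBottom ρ′) τ →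
      ∀ {x y} → ρ ⟨$⟩ˡ x Fin.< ρ ⟨$⟩ˡ y → ρ′ ⟨$⟩ˡ x Fin.< ρ′ ⟨$⟩ˡ y
    transfer {ρ} {ρ′} av av′ m m′ {x} {y} lt with Fin.<-cmp (ρ′ ⟨$⟩ˡ x) (ρ′ ⟨$⟩ˡ y)
    ... | tri< lt′ _ _ = lt′
    ... | tri≈ _ eq _  = contradiction (trans (sym (inverseʳ ρ′)) (trans (cong (ρ′ ⟨$⟩ʳ_) eq) (inverseʳ ρ′)))
                           λ x≡y → ℕ.<⇒≢ lt (cong (λ z → toℕ (ρ ⟨$⟩ˡ z)) x≡y)
    ... | tri> _ _ gt  = contradiction
      (subst₂ (Before τ) (inverseʳ ρ′) (inverseʳ ρ′) (<⇒Before av′ m′ gt))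
      (Before-asym τ (subst₂ (Before τ) (inverseʳ ρ) (inverseʳ ρ) (<⇒Before av m lt)))

  Avoids231-unique : σ ≈ σ′
  Avoids231-unique = order-preserving⇒≈ {σ = σ} {σ′} (transfer avoids avoids′ m m′) (transfer avoids′ avoids m′ m)

-- The 231-avoiding preimage of a 321-avoiding permutation

module _ {P : Pred (Fin n) 0ℓ} (P? : Decidable P) where

  below-suc-∉ : ∀ {x} → ¬ P x → below P? (suc (toℕ x)) ≤ below P? (toℕ x)
  below-suc-∉ {x} ¬p = #-mono {n = n} _ _ λ y (p , le) →
    p , ℕ.≤∧≢⇒< (s≤s⁻¹ le) λ eq → ¬p (subst P (Fin.toℕ-injective eq) p)

  below-suc : ∀ (x : Fin n) → below P? (suc (toℕ x)) ≤ suc (below P? (toℕ x))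
  below-suc x = begin
    below P? (suc (toℕ x))                    ≤⟨ #-mono {n = n} _ either? split ⟩
    # either?                                 ≡⟨ #-⊎ {n = n} (Fin._≟ x) _ either? (λ { _ (inj₁ p) → inj₂ p ; _ (inj₂ e) → inj₁ e })
                                                   (λ _ → inj₂) (λ _ → inj₁) (λ _ eq (_ , lt) → ℕ.<⇒≢ lt (cong toℕ eq)) ⟩
    # (Fin._≟ x) + below P? (toℕ x)           ≡⟨ cong (_+ below P? (toℕ x)) (#-singleton x) ⟩
    suc (below P? (toℕ x))                    ∎
    where
    open ℕ.≤-Reasoning
    either? : Decidable (λ y → (P y × toℕ y < toℕ x) ⊎ y ≡ x)
    either? y = (P? y ×-dec (toℕ y <? toℕ x)) ⊎-dec (y Fin.≟ x)
    split : ∀ y → P y × toℕ y < suc (toℕ x) → (P y × toℕ y < toℕ x) ⊎ y ≡ x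
    split y (p , le) with ℕ.m≤n⇒m<n∨m≡n (s≤s⁻¹ le)
    ... | inj₁ lt = inj₁ (p , lt)
    ... | inj₂ eq = inj₂ (Fin.toℕ-injective eq)

module _ {T B : Pred (Fin n) 0ℓ} {T? : Decidable T} {B? : Decidable B} {lo hi}
         (arcs : Arcs T? B? lo hi) where
  open Arcs arcs

  private
    -- From level x to x + 1, `over` gains 1 if x is in B and loses 1 if x is in T. Here `b` bounds
    -- the gain: 1 in general and 0 outside B.
    step : ∀ (x : Fin n) {b} → below B? (suc (toℕ x)) ≤ b + below B? (toℕ x) →
           below T? (suc (toℕ x)) + over (suc (toℕ x)) ≤ b + (below T? (toℕ x) + over (toℕ x))
    step x {b} le = subst₂ _≤_ (over-balance (suc (toℕ x))) (cong (b +_) (over-balance (toℕ x))) le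

  over-suc : ∀ (x : Fin n) → over (suc (toℕ x)) ≤ suc (over (toℕ x))
  over-suc x = ℕ.+-cancelˡ-≤ (below T? (toℕ x)) _ _ (begin
    below T? (toℕ x) + over (suc (toℕ x))       ≤⟨ ℕ.+-monoˡ-≤ _ (below-mono T? (ℕ.n≤1+n _)) ⟩
    below T? (suc (toℕ x)) + over (suc (toℕ x)) ≤⟨ step x {1} (below-suc B? x) ⟩
    suc (below T? (toℕ x) + over (toℕ x))       ≡⟨ ℕ.+-suc (below T? (toℕ x)) (over (toℕ x)) ⟨
    below T? (toℕ x) + suc (over (toℕ x))       ∎)
    where open ℕ.≤-Reasoning

  over-suc-top : ∀ {x} → T x → over (suc (toℕ x)) ≤ over (toℕ x)
  over-suc-top {x} t = ℕ.+-cancelˡ-≤ (suc (below T? (toℕ x))) _ _ (ℕ.≤-trans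
    (ℕ.+-monoˡ-≤ (over (suc (toℕ x))) (below-strict T? t ℕ.≤-refl)) (step x {1} (below-suc B? x)))

  over-suc-nonbottom : ∀ {x} → ¬ B x → over (suc (toℕ x)) ≤ over (toℕ x)
  over-suc-nonbottom {x} ¬b = ℕ.+-cancelˡ-≤ (below T? (toℕ x)) _ _ (ℕ.≤-trans
    (ℕ.+-monoˡ-≤ (over (suc (toℕ x))) (below-mono T? (ℕ.n≤1+n (toℕ x)))) (step x {0} (below-suc-∉ B? ¬b)))

  over-suc-top-nonbottom : ∀ {x} → T x → ¬ B x → over (suc (toℕ x)) < over (toℕ x)
  over-suc-top-nonbottom {x} t ¬b = ℕ.+-cancelˡ-< (below T? (toℕ x)) _ _ (ℕ.<-≤-trans
    (ℕ.+-monoˡ-< (over (suc (toℕ x))) (below-strict T? t ℕ.≤-refl)) (step x {0} (below-suc-∉ B? ¬b)))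

injective⇒surjective : {f : Fin n → Fin n} → (∀ {x y} → f x ≡ f y → x ≡ y) → ∀ y → ∃[ x ] f x ≡ y
injective⇒surjective {n} {f} f-injective y with Fin.any? (λ x → f x Fin.≟ y)
... | yes hit = hit
... | no miss = contradiction
  -- `i Fin.≟ i` decides the predicate that holds everywhere: if y is missed, f injects all of
  -- `Fin n` into the complement of y.
  (#-injection (λ i → i Fin.≟ i) (λ i → ¬? (i Fin.≟ y)) (λ x z → f x ≡ z)
    (λ x _ → f x , (λ eq → miss (x , eq)) , refl) (λ _ _ _ p q → f-injective (trans p (sym q))))
  (ℕ.<⇒≱ (#-strict (λ i → ¬? (i Fin.≟ y)) (λ i → i Fin.≟ i) (λ _ _ → refl) y refl λ ¬refl → ¬refl refl))

Drop DropValue : Permutation′ n → Pred (Fin n) 0ℓ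
Drop      τ x = τ ⟨$⟩ʳ x Fin.< x
DropValue τ x = x Fin.< τ ⟨$⟩ˡ x

Drop? : (τ : Permutation′ n) → Decidable (Drop τ)
Drop? τ x = _ Fin.<? _

DropValue? : (τ : Permutation′ n) → Decidable (DropValue τ)
DropValue? τ x = _ Fin.<? _

module _ {τ : Permutation′ n} (avoids : Avoids321 τ) where

  private
    -- There are a positions to the left of a, but fewer than a values below τ(a).
    larger-left : ∀ {a} → Drop τ a → ∃[ k ] k Fin.< a × τ ⟨$⟩ʳ a Fin.< τ ⟨$⟩ʳ k
    larger-left {a} drop with Fin.any? (λ k → (k Fin.<? a) ×-dec (τ ⟨$⟩ʳ a Fin.<? τ ⟨$⟩ʳ k))
    ... | yes found = found
    ... | no none   = contradiction drop (ℕ.≤⇒≯ (subst₂ _≤_ (#-initial a)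
        (trans (sym (#-reindex τ (λ (v : Fin n) → v Fin.<? τ ⟨$⟩ʳ a))) (#-initial (τ ⟨$⟩ʳ a)))
        (#-mono {n = n} (λ k → k Fin.<? a) (λ k → τ ⟨$⟩ʳ k Fin.<? τ ⟨$⟩ʳ a) smaller)))
      where
      smaller : ∀ k → k Fin.< a → τ ⟨$⟩ʳ k Fin.< τ ⟨$⟩ʳ a
      smaller k k<a = ℕ.≤∧≢⇒< (ℕ.≮⇒≥ λ lt → none (k , k<a , lt))
        λ eq → ℕ.<⇒≢ k<a (cong toℕ (ʳ-injective τ (Fin.toℕ-injective eq)))

    -- Otherwise all values below τ(b) would stand to the left of b and avoid position a, making
    -- τ(b) < b.
    smaller-right : ∀ {a b} → ¬ Drop τ b → a Fin.< b → τ ⟨$⟩ʳ b Fin.< τ ⟨$⟩ʳ a →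
                    ∃[ k ] b Fin.< k × τ ⟨$⟩ʳ k Fin.< τ ⟨$⟩ʳ b
    smaller-right {a} {b} ¬drop a<b inv with Fin.any? (λ k → (b Fin.<? k) ×-dec (τ ⟨$⟩ʳ k Fin.<? τ ⟨$⟩ʳ b))
    ... | yes found = found
    ... | no none   = contradiction (subst₂ _<_
        (trans (sym (#-reindex τ (λ (v : Fin n) → v Fin.<? τ ⟨$⟩ʳ b))) (#-initial (τ ⟨$⟩ʳ b))) (#-initial b)
        (#-strict {n = n} (λ k → τ ⟨$⟩ʳ k Fin.<? τ ⟨$⟩ʳ b) (λ k → k Fin.<? b) left a a<b (ℕ.<⇒≯ inv))) ¬drop
      where
      left : ∀ k → τ ⟨$⟩ʳ k Fin.< τ ⟨$⟩ʳ b → k Fin.< b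
      left k lt = ℕ.≤∧≢⇒< (ℕ.≮⇒≥ λ b<k → none (k , b<k , lt))
        λ eq → ℕ.<⇒≢ lt (cong (toℕ ∘ (τ ⟨$⟩ʳ_)) (Fin.toℕ-injective eq))

  -- An inversion between drops extends to a 321 on the left, one between nondrops on the right.
  Avoids321⇒Monotone : Monotone (Drop τ) (DropValue τ) τ
  Avoids321⇒Monotone = record
    { image  = λ {b} → subst (τ ⟨$⟩ʳ b Fin.<_) (sym (inverseˡ τ))
    ; image⁻ = λ {b} → subst (τ ⟨$⟩ʳ b Fin.<_) (inverseˡ τ)
    ; mono   = λ {a} {b} s t a<b → increasing a<b λ inv →
        let k , k<a , gt = larger-left s in avoids (k , a , b , k<a , a<b , inv , gt)
    ; mono-∁ = λ {a} {b} s t a<b → increasing a<b λ inv →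
        let k , b<k , lt = smaller-right t a<b inv in avoids (a , b , k , a<b , b<k , lt , inv)
    }
    where
    increasing : ∀ {a b} → a Fin.< b → ¬ (τ ⟨$⟩ʳ b Fin.< τ ⟨$⟩ʳ a) → τ ⟨$⟩ʳ a Fin.< τ ⟨$⟩ʳ b
    increasing a<b ¬inv = ℕ.≤∧≢⇒< (ℕ.≮⇒≥ ¬inv)
      λ eq → ℕ.<⇒≢ a<b (cong toℕ (ʳ-injective τ (Fin.toℕ-injective eq)))

  private
    monotone = Avoids321⇒Monotone
    arcs : Arcs (Drop? τ) (DropValue? τ) (letter τ) (suc ∘ toℕ)
    arcs = dropArcs id id monotone
    H : ℕ → ℕ
    H = dropLevel τ

  -- The level condition is inherited by shorter ranges. This is also the source of 231-avoidance: a
  -- letter to the left of a smaller one is to the left of all letters between them in value.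
  Covers-interval : ∀ {a b c} → Covers τ a c → c Fin.< b → b Fin.< a → Covers τ a b
  Covers-interval (_ , drop , levels) c<b b<a = b<a , drop , λ z b<z → levels z (ℕ.<-trans c<b b<z)

  Covers-trans : ∀ {a b c} → Covers τ a b → Covers τ b c → Covers τ a c
  Covers-trans {a} {b} (b<a , drop , levels) (c<b , drop′ , levels′) = ℕ.<-trans c<b b<a , drop , levels″
    where
    levels″ : ∀ z → _ < z → z ≤ toℕ a → H (toℕ a) ≤ H z
    levels″ z c<z z≤a with z ≤? toℕ b
    -- The level does not rise past the drop b, so the bound at b + 1, within the range of the first
    -- covering, carries over to b.
    ... | yes z≤b = ℕ.≤-trans (levels (suc (toℕ b)) ℕ.≤-refl b<a)
                      (ℕ.≤-trans (over-suc-top arcs drop′) (levels′ z c<z z≤b))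
    ... | no  z≰b = levels z (ℕ.≰⇒> z≰b) z≤a

  Covers? : ∀ y x → Dec (Covers τ y x)
  Covers? y x = (x Fin.<? y) ×-dec Drop? τ y ×-dec
    map′ (λ f z lo hi → f {z} (s≤s hi) lo) (λ f {z} hi lo → f z lo (s≤s⁻¹ hi))
      (ℕ.allUpTo? (λ z → (toℕ x <? z) →-dec (H (toℕ y) ≤? H z)) (suc (toℕ y)))

  Before? : ∀ y x → Dec (Before τ y x)
  Before? y x = Covers? y x ⊎-dec ((y Fin.<? x) ×-dec ¬? (Covers? x y))

  Before-irrefl : ∀ {x} → ¬ Before τ x x
  Before-irrefl p = Before-asym τ p p

  Before-total : ∀ {x y} → x ≢ y → Before τ x y ⊎ Before τ y x
  Before-total {x} {y} x≢y with Fin.<-cmp x y | Covers? x y | Covers? y x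
  ... | tri≈ _ eq _ | _        | _        = contradiction eq x≢y
  ... | _           | yes cov  | _        = inj₁ (inj₁ cov)
  ... | _           | no _     | yes cov  = inj₂ (inj₁ cov)
  ... | tri< lt _ _ | no _     | no ¬cov  = inj₁ (inj₂ (lt , ¬cov))
  ... | tri> _ _ gt | no ¬cov  | no _     = inj₂ (inj₂ (gt , ¬cov))

  -- `Covers` acts as an inversion set: `Covers-trans` composes inversions and `Covers-interval`
  -- composes noninversions. The mixed cases reduce to these two once a and c are compared.
  Before-trans : ∀ {a b c} → Before τ a b → Before τ b c → Before τ a c
  Before-trans (inj₁ ab) (inj₁ bc) = inj₁ (Covers-trans ab bc)
  Before-trans {a} {b} {c} (inj₁ ab) (inj₂ (b<c , ¬cb)) with Fin.<-cmp c a
  ... | tri< c<a _ _  = inj₁ (Covers-interval ab b<c c<a)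
  ... | tri≈ _ refl _ = contradiction ab ¬cb
  ... | tri> _ _ a<c  = inj₂ (a<c , λ ca → ¬cb (Covers-trans ca ab))
  Before-trans {a} {b} {c} (inj₂ (a<b , ¬ba)) (inj₁ bc) with Fin.<-cmp c a
  ... | tri< c<a _ _  = contradiction (Covers-interval bc c<a a<b) ¬ba
  ... | tri≈ _ refl _ = contradiction bc ¬ba
  ... | tri> _ _ a<c  = inj₂ (a<c , λ ca → ¬ba (Covers-trans bc ca))
  Before-trans (inj₂ (a<b , ¬ba)) (inj₂ (b<c , ¬cb)) =
    inj₂ (ℕ.<-trans a<b b<c , λ ca → ¬cb (Covers-interval ca a<b b<c))

  private
    predecessors : Fin n → ℕ
    predecessors x = # (λ y → Before? y x)

    predecessors<n : ∀ x → predecessors x < n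
    predecessors<n x = ℕ.<-≤-trans
      (#-strict (λ y → Before? y x) (λ y → y Fin.≟ y) (λ _ _ → refl) x refl Before-irrefl)
      (ℕ.≤-trans (List.length-filter (λ y → y Fin.≟ y) (allFin n)) (ℕ.≤-reflexive (List.length-tabulate id)))

    position : Fin n → Fin n
    position x = fromℕ< (predecessors<n x)

    toℕ-position : ∀ x → toℕ (position x) ≡ predecessors x
    toℕ-position x = Fin.toℕ-fromℕ< (predecessors<n x)

    position-mono : ∀ {x y} → Before τ x y → position x Fin.< position y
    position-mono {x} {y} p = subst₂ _<_ (sym (toℕ-position x)) (sym (toℕ-position y))
      (#-strict (λ z → Before? z x) (λ z → Before? z y) (λ _ q → Before-trans q p) x p Before-irrefl)

    position-injective : ∀ {x y} → position x ≡ position y → x ≡ y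
    position-injective {x} {y} eq = decidable-stable (x Fin.≟ y) λ x≢y →
      [ (λ p → contradiction (cong toℕ eq) (ℕ.<⇒≢ (position-mono p)))
      , (λ p → contradiction (cong toℕ (sym eq)) (ℕ.<⇒≢ (position-mono p))) ]′ (Before-total x≢y)

  preimage : Permutation′ n
  preimage = permutation (λ i → proj₁ (injective⇒surjective position-injective i)) position
    (λ x → position-injective (proj₂ (injective⇒surjective position-injective (position x))))
    (λ i → proj₂ (injective⇒surjective position-injective i))

  -- The only property of `preimage` on which the identification of its tops and bottoms relies.
  preimage-mono : ∀ {x y} → Before τ x y → preimage ⟨$⟩ˡ x Fin.< preimage ⟨$⟩ˡ y
  preimage-mono = position-mono

-- Descent tops and bottoms of the constructed word

module Preimage {τ : Permutation′ n} (avoids : Avoids321 τ) (σ : Permutation′ n)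
                (position-mono : ∀ {x y} → Before τ x y → σ ⟨$⟩ˡ x Fin.< σ ⟨$⟩ˡ y) where
  private
    monotone : Monotone (Drop τ) (DropValue τ) τ
    monotone = Avoids321⇒Monotone {τ = τ} avoids
    arcs : Arcs (Drop? τ) (DropValue? τ) (letter τ) (suc ∘ toℕ)
    arcs = dropArcs id id monotone
    H : ℕ → ℕ
    H = dropLevel τ

    Before⇒< : ∀ {i j} → Before τ (σ ⟨$⟩ʳ i) (σ ⟨$⟩ʳ j) → i Fin.< j
    Before⇒< p = subst₂ Fin._<_ (inverseˡ σ) (inverseˡ σ) (position-mono p)

    <⇒Before′ : ∀ {i j} → i Fin.< j → Before τ (σ ⟨$⟩ʳ i) (σ ⟨$⟩ʳ j)
    <⇒Before′ {i} {j} i<j = [ id , (λ p → contradiction (Before⇒< p) (ℕ.<⇒≯ i<j)) ]′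
      (Before-total {τ = τ} avoids λ eq → ℕ.<⇒≢ i<j (cong toℕ (ʳ-injective σ eq)))

    inversion⇒Covers′ : ∀ {i j} → i Fin.< j → σ ⟨$⟩ʳ j Fin.< σ ⟨$⟩ʳ i → Covers τ (σ ⟨$⟩ʳ i) (σ ⟨$⟩ʳ j)
    inversion⇒Covers′ i<j inv = [ id , (λ (lt , _) → contradiction lt (ℕ.<⇒≯ inv)) ]′ (<⇒Before′ i<j)

    no-between : ∀ {i j} → i ⋖ j → ∀ w → Before τ (σ ⟨$⟩ʳ i) w → ¬ Before τ w (σ ⟨$⟩ʳ j)
    no-between {i} {j} i⋖j w p q = ℕ.<⇒≱
      (Before⇒< (subst (Before τ (σ ⟨$⟩ʳ i)) (sym (inverseʳ σ)) p))
      (⋖-below {i = i} {j = j} {k = σ ⟨$⟩ˡ w} i⋖j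
        (Before⇒< (subst (λ v → Before τ v (σ ⟨$⟩ʳ j)) (sym (inverseʳ σ)) q)))

  preimage-avoids : Avoids231 σ
  preimage-avoids (i , j , k , i<j , j<k , r<p , p<q) = Before-asym τ (<⇒Before′ i<j)
    (inj₁ (Covers-interval {τ = τ} avoids (inversion⇒Covers′ j<k (ℕ.<-trans r<p p<q)) r<p p<q))

  private
    top⇒Drop : ∀ x → DescentTop σ x → Drop τ x
    top⇒Drop x t = let j , i⋖j , desc = descent⇒⋖ σ t in
      subst (Drop τ) (inverseʳ σ) (proj₁ (proj₂ (inversion⇒Covers′ (⋖⇒< i⋖j) desc)))

    Covers-⋖ : ∀ {x y} → x ⋖ y → Drop τ y → Covers τ y x
    Covers-⋖ {x} {y} x⋖y drop = ⋖⇒< x⋖y , drop ,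
      λ z x<z z≤y → ℕ.≤-reflexive (cong H (ℕ.≤-antisym (subst (_≤ z) (sym x⋖y) x<z) z≤y))

    pred : ∀ {y x : Fin n} → x Fin.< y → ∃[ w ] w ⋖ y
    pred {suc y} _ = inject₁ y , cong suc (sym (Fin.toℕ-inject₁ y))

    -- A drop x covers x - 1, as the level of x is the only one to compare. So x has a smaller
    -- letter to its right, and 231-avoidance puts a descent at x.
    Drop⇒top : ∀ x → Drop τ x → DescentTop σ x
    Drop⇒top x drop = let w , w⋖x = pred {y = x} drop in
      subst (DescentTop σ) (inverseʳ σ)
        (inversion⇒descent preimage-avoids {i = σ ⟨$⟩ˡ x} {j = σ ⟨$⟩ˡ w} (position-mono (inj₁ (Covers-⋖ w⋖x drop)))
          (subst₂ Fin._<_ (sym (inverseʳ σ)) (sym (inverseʳ σ)) (⋖⇒< w⋖x)))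

    H-zero : H 0 ≡ 0
    H-zero = #-empty {n = n} _ λ _ (le , _) → ℕ.n≮0 le

    H-drop : ∀ {y} → Drop τ y → 0 < H (toℕ y)
    H-drop {y} drop = #-positive {n = n} _ y (drop , ℕ.≤-refl)

    -- The walk down from x stops at the largest w < x to the left of x. The level cannot have dropped
    -- below that of y by then, so y lies to the left of w.
    separator : ∀ {x y} → Covers τ y x → ¬ DropValue τ x → ∃[ w ] Covers τ y w × w Fin.< x × ¬ Covers τ x w
    separator {x} {y} (x<y , drop , levels) ¬value = go (toℕ x) ℕ.≤-refl start
      where
      above : ℕ → Set
      above u = ∀ z → u ≤ z → z ≤ toℕ y → H (toℕ y) ≤ H z

      cons : ∀ {u} → H (toℕ y) ≤ H u → above (suc u) → above u
      cons Hy≤Hu f z u≤z z≤y with ℕ.m≤n⇒m<n∨m≡n u≤z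
      ... | inj₁ u<z  = f z u<z z≤y
      ... | inj₂ refl = Hy≤Hu

      at-suc-x : H (toℕ y) ≤ H (suc (toℕ x))
      at-suc-x = levels (suc (toℕ x)) ℕ.≤-refl x<y

      start : above (toℕ x)
      start = cons (ℕ.≤-trans at-suc-x (over-suc-nonbottom arcs ¬value)) levels

      go : ∀ u → u ≤ toℕ x → above u → ∃[ w ] Covers τ y w × w Fin.< x × ¬ Covers τ x w
      -- The walk cannot reach the bottom: level 0 is crossed by nothing, while the level of y is
      -- crossed by the drop at y.
      go zero    _   f = contradiction (subst (H (toℕ y) ≤_) H-zero (f 0 z≤n z≤n)) (ℕ.<⇒≱ (H-drop drop))
      go (suc u) u<x f = continue (Covers? {τ = τ} avoids x w)
        where
        w : Fin n
        w = fromℕ< (ℕ.<-trans u<x (Fin.toℕ<n x))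
        w≡u : toℕ w ≡ u
        w≡u = Fin.toℕ-fromℕ< _
        w<x : w Fin.< x
        w<x = subst (_< toℕ x) (sym w≡u) u<x
        continue : Dec (Covers τ x w) → ∃[ w ] Covers τ y w × w Fin.< x × ¬ Covers τ x w
        continue (no ¬cov) =
          w , (ℕ.<-trans w<x x<y , drop , λ z w<z → f z (subst (_< z) w≡u w<z)) , w<x , ¬cov
        continue (yes (_ , dropx , levelsx)) = go u (ℕ.<⇒≤ u<x) (cons Hy≤Hu f)
          where
          -- Here x is a drop but not a drop value, so the level falls strictly past x. This
          -- compensates for the rise by at most one past w.
          Hy≤Hu : H (toℕ y) ≤ H u
          Hy≤Hu = s≤s⁻¹ (begin
            suc (H (toℕ y))       ≤⟨ s≤s at-suc-x ⟩
            suc (H (suc (toℕ x))) ≤⟨ over-suc-top-nonbottom arcs dropx ¬value ⟩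
            H (toℕ x)             ≤⟨ levelsx (suc (toℕ w)) ℕ.≤-refl w<x ⟩
            H (suc (toℕ w))       ≤⟨ over-suc arcs w ⟩
            suc (H (toℕ w))       ≡⟨ cong (suc ∘ H) w≡u ⟩
            suc (H u)             ∎)
            where open ℕ.≤-Reasoning

    -- Otherwise the separating letter w would stand strictly between the adjacent letters of the
    -- descent ending at x.
    bottom⇒DropValue : ∀ x → DescentBottom σ x → DropValue τ x
    bottom⇒DropValue x b = decidable-stable (DropValue? τ x) λ ¬value →
      let i , i⋖j , desc = descent⇒⋖ˡ σ b
          w , yw , w<x , ¬xw = separator (subst (Covers τ (σ ⟨$⟩ʳ i)) (inverseʳ σ) (inversion⇒Covers′ (⋖⇒< i⋖j) desc)) ¬value
      in no-between i⋖j w (inj₁ yw) (subst (Before τ w) (sym (inverseʳ σ)) (inj₂ (w<x , ¬xw)))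

    -- The inclusion just shown is between sets of equal size, since drops and tops already agree.
    DropValue⇒bottom : ∀ x → DropValue τ x → DescentBottom σ x
    DropValue⇒bottom = #-full⇒⊇ (DescentBottom? σ) (DropValue? τ) bottom⇒DropValue (ℕ.≤-reflexive (begin
      # (DropValue? τ)               ≡⟨ #-reindex τ (DropValue? τ) ⟩
      # (λ b → DropValue? τ (τ ⟨$⟩ʳ b))                            ≡⟨ #-cong {n = n} _ (Drop? τ) (λ _ → image⁻ monotone) (λ _ → image monotone) ⟩
      # (Drop? τ)                    ≡⟨ #-cong (Drop? τ) (DescentTop? σ) Drop⇒top top⇒Drop ⟩
      # (DescentTop? σ)              ≡⟨ below-all (DescentTop? σ) ⟨
      below (DescentTop? σ) n        ≡⟨ below-bottoms σ ⟨
      below (DescentBottom? σ) n     ≡⟨ below-all (DescentBottom? σ) ⟩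
      # (DescentBottom? σ)           ∎))
      where open ≡-Reasoning

  -- Applied to υ = `Φ σ`: it is monotone for the same two sets as τ, and such a permutation is
  -- unique.
  preimage-unique : ∀ {υ} → Monotone (DescentTop σ) (DescentBottom σ) υ → υ ≈ τ
  preimage-unique {υ} m = Monotone-unique (Drop? τ) (DropValue? τ) {υ} {τ}
    (Monotone-resp {τ = υ} top⇒Drop Drop⇒top bottom⇒DropValue DropValue⇒bottom m) monotone

-- Bijectivity

DescentTop-resp-≈ : {σ σ′ : Permutation′ n} → σ ≈ σ′ → ∀ x → DescentTop σ x → DescentTop σ′ x
DescentTop-resp-≈ {σ = σ} {σ′} σ≈σ′ x t =
  let j , i⋖j , desc = descent⇒⋖ σ t
  in subst (DescentTop σ′) (trans (sym (σ≈σ′ _)) (inverseʳ σ))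
       (descentTop⁺ σ′ (⋖⇒descent σ′ i⋖j (subst₂ Fin._<_ (σ≈σ′ _) (σ≈σ′ _) desc)))

DescentBottom-resp-≈ : {σ σ′ : Permutation′ n} → σ ≈ σ′ → ∀ x → DescentBottom σ x → DescentBottom σ′ x
DescentBottom-resp-≈ {σ = σ} {σ′} σ≈σ′ x b =
  let i , i⋖j , desc = descent⇒⋖ˡ σ b
  in subst (DescentBottom σ′) (trans (sym (σ≈σ′ _)) (inverseʳ σ))
       (descentBottom⁺ σ′ (⋖⇒descentˡ σ′ i⋖j (subst₂ Fin._<_ (σ≈σ′ _) (σ≈σ′ _) desc)))

Monotone-≈ : {T B : Pred (Fin n) 0ℓ} {τ υ : Permutation′ n} → τ ≈ υ → Monotone T B τ → Monotone T B υ
Monotone-≈ {B = B} τ≈υ m = record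
  { image  = λ t → subst B (τ≈υ _) (image m t)
  ; image⁻ = λ b → image⁻ m (subst B (sym (τ≈υ _)) b)
  ; mono   = λ s t lt → subst₂ Fin._<_ (τ≈υ _) (τ≈υ _) (mono m s t lt)
  ; mono-∁ = λ s t lt → subst₂ Fin._<_ (τ≈υ _) (τ≈υ _) (mono-∁ m s t lt)
  }

module _ {σ σ′ τ τ′ : Permutation′ n}
         (m : Monotone (DescentTop σ) (DescentBottom σ) τ)
         (m′ : Monotone (DescentTop σ′) (DescentBottom σ′) τ′) where

  Monotone-cong : σ ≈ σ′ → τ ≈ τ′
  Monotone-cong σ≈σ′ = Monotone-unique (DescentTop? σ′) (DescentBottom? σ′) {τ} {τ′}
    (Monotone-resp {τ = τ}
      (DescentTop-resp-≈ {σ = σ} {σ′} σ≈σ′) (DescentTop-resp-≈ {σ = σ′} {σ} (sym ∘ σ≈σ′))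
      (DescentBottom-resp-≈ {σ = σ} {σ′} σ≈σ′) (DescentBottom-resp-≈ {σ = σ′} {σ} (sym ∘ σ≈σ′)) m)
    m′

  Monotone-injective : Avoids231 σ → Avoids231 σ′ → τ ≈ τ′ → σ ≈ σ′
  Monotone-injective av av′ τ≈τ′ =
    Avoids231-unique {σ = σ} {σ′} av av′ {τ′} (Monotone-≈ {τ = τ} {τ′} τ≈τ′ m) m′

-- `≈` compares values only. Equal words have the same tops and bottoms, and monotone permutations
-- for these agree, so the lists inside `Φ` need not be compared.
Φ-cong : {σ σ′ : Permutation′ n} → Avoids231 σ → Avoids231 σ′ → σ ≈ σ′ → Φ σ ≈ Φ σ′
Φ-cong {σ = σ} {σ′} av av′ = Monotone-cong {σ = σ} {σ′} {Φ σ} {Φ σ′} (Φ-monotone {σ = σ} av) (Φ-monotone {σ = σ′} av′)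

Φ-injective : {σ σ′ : Permutation′ n} → Avoids231 σ → Avoids231 σ′ → Φ σ ≈ Φ σ′ → σ ≈ σ′
Φ-injective {σ = σ} {σ′} av av′ =
  Monotone-injective {σ = σ} {σ′} {Φ σ} {Φ σ′} (Φ-monotone {σ = σ} av) (Φ-monotone {σ = σ′} av′) av av′

Φ-avoids : {σ : Permutation′ n} → Avoids231 σ → Avoids321 (Φ σ)
Φ-avoids {σ = σ} av = Monotone⇒Avoids321 (DescentTop? σ) {Φ σ} (Φ-monotone {σ = σ} av)

Φ-surjective : {τ : Permutation′ n} → Avoids321 τ → ∃[ σ ] Avoids231 σ × Φ σ ≈ τ
Φ-surjective {τ = τ} av = σ , σ-avoids ,
  Preimage.preimage-unique {τ = τ} av σ (preimage-mono {τ = τ} av) {Φ σ} (Φ-monotone {σ = σ} σ-avoids)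
  where
  σ = preimage {τ = τ} av
  σ-avoids : Avoids231 σ
  σ-avoids = Preimage.preimage-avoids {τ = τ} av σ (preimage-mono {τ = τ} av)

Φ-bijection : ∀ n → Bijection (𝔖231 n) (𝔖321 n)
Φ-bijection n = record
  { to        = λ (σ , av) → Φ σ , Φ-avoids {σ = σ} av
  ; cong      = λ {(σ , av)} {(σ′ , av′)} → Φ-cong {σ = σ} {σ′} av av′
  ; bijective = (λ {(σ , av)} {(σ′ , av′)} → Φ-injective {σ = σ} {σ′} av av′) , surjective
  }
  where
  surjective : ∀ ((τ , _) : Σ[ τ ∈ Permutation′ n ] Avoids321 τ) →
    ∃[ (σ , _) ] (∀ {(σ′ , _) : Σ[ σ ∈ Permutation′ n ] Avoids231 σ} → σ′ ≈ σ → Φ σ′ ≈ τ)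
  surjective (τ , av) = let σ , av′ , Φσ≈τ = Φ-surjective {τ = τ} av in
    -- Surjectivity between setoids asks for the value at every σ′ equivalent to the chosen σ.
    (σ , av′) , λ {(σ′ , av″)} σ′≈σ i → trans (Φ-cong {σ = σ′} {σ} av″ av′ σ′≈σ i) (Φσ≈τ i)

-- The two equalities of statistics

open import Data.Integer.Base using (+_; _⊖_)

lda⊖fmax : {σ : Permutation′ n} → Avoids231 σ → ∀ {τ} → Monotone (DescentTop σ) (DescentBottom σ) τ →
           lda σ ⊖ fmax σ ≡ + cda τ
lda⊖fmax {σ = σ} av {τ} m = begin
  lda σ ⊖ fmax σ            ≡⟨ cong₂ _⊖_ (lda≡fix+cda av m) (fmax≡fix av m) ⟩
  (fix τ + cda τ) ⊖ fix τ   ≡⟨ ℤ.⊖-≥ (ℕ.m≤m+n (fix τ) (cda τ)) ⟩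
  + (fix τ + cda τ ∸ fix τ) ≡⟨ cong +_ (ℕ.m+n∸m≡n (fix τ) (cda τ)) ⟩
  + cda τ                   ∎
  where open ≡-Reasoning

theorem2p11 : (n : ℕ) → n ≥ 1 →
    (Σ[ Φ∣ ∈ Bijection (𝔖231 n) (𝔖321 n) ]
      (∀ σ → proj₁ (Bijection.to Φ∣ σ) ≈ Φ (proj₁ σ)))
    ×
    (∀ (σ : Permutation′ n) → Avoids231 σ →
      let τ = Φ σ
          τ⁻¹ = flip (Φ σ)
      in
      (31-2 σ ,′ des σ ,′ asc∞ σ ,′ lda σ ⊖ fmax σ ,′ ldd σ ,′ lval σ ,′ lpk σ ,′ fmax σ)
        ≡ (icr τ ,′ drop τ ,′ exc τ + fix τ ,′ + cda τ ,′ cdd τ ,′ cval τ ,′ cpk τ ,′ fix τ)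
      ×
      (icr τ ,′ drop τ ,′ exc τ + fix τ ,′ + cda τ ,′ cdd τ ,′ cval τ ,′ cpk τ ,′ fix τ)
        ≡ (cros τ⁻¹ ,′ exc τ⁻¹ ,′ drop τ⁻¹ + fix τ⁻¹ ,′ + cdd τ⁻¹ ,′ cda τ⁻¹ ,′ cval τ⁻¹ ,′ cpk τ⁻¹ ,′ fix τ⁻¹))
theorem2p11 n _ = (Φ-bijection n , λ _ _ → refl) , λ σ av → statistics {σ} av {Φ σ} (Φ-monotone {σ = σ} av) , statistics-flip (Φ σ)
  where
  infixr 4 _,≡_
  _,≡_ : {A B : Set} {a a′ : A} {b b′ : B} → a ≡ a′ → b ≡ b′ → (a ,′ b) ≡ (a′ ,′ b′)
  _,≡_ = cong₂ _,′_

  statistics : {σ : Permutation′ n} → Avoids231 σ → ∀ {τ} → Monotone (DescentTop σ) (DescentBottom σ) τ →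
    (31-2 σ ,′ des σ ,′ asc∞ σ ,′ lda σ ⊖ fmax σ ,′ ldd σ ,′ lval σ ,′ lpk σ ,′ fmax σ)
      ≡ (icr τ ,′ drop τ ,′ exc τ + fix τ ,′ + cda τ ,′ cdd τ ,′ cval τ ,′ cpk τ ,′ fix τ)
  statistics av m = 31-2≡icr av m ,≡ des≡drop av m ,≡ asc∞≡exc+fix av m ,≡ lda⊖fmax av m ,≡
    ldd≡cdd av m ,≡ lval≡cval av m ,≡ lpk≡cpk av m ,≡ fmax≡fix av m

  statistics-flip : (τ : Permutation′ n) → let τ⁻¹ = flip τ in
    (icr τ ,′ drop τ ,′ exc τ + fix τ ,′ + cda τ ,′ cdd τ ,′ cval τ ,′ cpk τ ,′ fix τ)
      ≡ (cros τ⁻¹ ,′ exc τ⁻¹ ,′ drop τ⁻¹ + fix τ⁻¹ ,′ + cdd τ⁻¹ ,′ cda τ⁻¹ ,′ cval τ⁻¹ ,′ cpk τ⁻¹ ,′ fix τ⁻¹)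
  -- Inverting τ exchanges `exc` with `drop` and `cda` with `cdd`; the first entries agree by the
  -- definition of `icr`.
  statistics-flip τ = sym (refl ,≡ exc-flip τ ,≡ cong₂ _+_ (drop-flip τ) (fix-flip τ) ,≡ cong +_ (cdd-flip τ) ,≡
    cda-flip τ ,≡ cval-flip τ ,≡ cpk-flip τ ,≡ fix-flip τ)
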